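{- Let $\mathcal{P}$ be a monotone property of ordered graphs. Suppose that for every constant $c > 0$ there exists $N = N(c) \in \mathbb{N}$ such that $|\mathcal{P}_N| > c^N$. Then $\mathcal{P}$ contains the ordered graph $H(\pi)$ for every $k \in \mathbb{N}$ and every permutation $\pi$ of $[k]$, and hence $$|\mathcal{P}_n| \ge |\mathcal{P}^{(1,2)}_n| \ge \sum_{k=0}^{\lfloor n/2 \rfloor} \binom{n}{2k} k! = n^{n/2 + o(n)}$$ for every $n \in \mathbb{N}$. This lower bound is best possible, and there is a unique monotone property of ordered graphs with this speed, i.e. there is exactly one monotone property $\mathcal{Q}$ of ordered graphs with $|\mathcal{Q}_n| = \sum_{k=0}^{\lfloor n/2 \rfloor} \binom{n}{2k} k!$ for every $n \in \mathbb{N}$.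
   Context: An ordered graph is a finite (simple, undirected) graph together with a linear order on its vertices. A property of ordered graphs is a collection of ordered graphs closed under order-preserving isomorphisms. It is monotone if it is closed under taking subgraphs (on any subset of the vertices with the induced order, and with any subset of the edges induced there). $\mathcal{P}_n$ is the collection of distinct (non-isomorphic under order-preserving isomorphism) ordered graphs on $n$ vertices in $\mathcal{P}$, and the speed of $\mathcal{P}$ is the function $n \mapsto |\mathcal{P}_n|$. $\mathcal{P}^{(1,2)}$ denotes the set of ordered graphs in $\mathcal{P}$ with maximum degree at most $1$. For a permutation $\pi$ of $[k] = \{1,\ldots,k\}$, $H(\pi)$ is the ordered graph with vertex set $[2k]$ (usual order) and edge set $\{\{i,\pi(i)+k\} : i \in [k]\}$. -}

module Defs where

open import Algebra.Definitions.RawSemiring using () renaming (_^_ to pow)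
open import Data.Fin.Base as Fin using (Fin; _↑ˡ_; _↑ʳ_)
open import Data.Fin.Permutation using (Permutation′; _⟨$⟩ʳ_)
import Data.Fin.Properties as Fin
open import Data.Integer.Base using (+_)
open import Data.List.Base using (List; allFin; filter; length; map; sum; upTo)
open import Data.List.Extrema.Nat using (max)
open import Data.Nat.Base using (ℕ; suc; _+_; _*_; _^_; _≤_; _<_; ⌊_/2⌋; _!)
open import Data.Nat.Combinatorics using (_C_)
open import Data.Product.Base using (Σ; ∃; ∃-syntax; _×_; _,_; proj₁)
open import Data.Rational.Base as ℚ using (ℚ; 0ℚ)
open import Data.Sum.Base using (_⊎_; inj₁; inj₂; swap)
open import Function.Base using (_∘_; _on_)
open import Function.Bundles using (Injection; Inverse; _↔_; _⇔_)
open import Function.Definitions using (Injective)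
open import Function.Construct.Composition using (_↔-∘_; _⇔-∘_)
open import Function.Construct.Identity using (↔-id; ⇔-id)
open import Function.Construct.Symmetry using (↔-sym; ⇔-sym)
open import Level using (Level; 0ℓ; _⊔_) renaming (suc to lsuc)
open import Relation.Binary.Bundles using (Setoid)
open import Relation.Binary.Core using (Rel)
import Relation.Binary.Construct.On as On
open import Relation.Binary.Definitions using (Decidable; Irreflexive; Symmetric; _Respects_)
open import Relation.Binary.PropositionalEquality using (_≡_; _≢_; refl; sym; trans; subst₂; setoid; cong)
open import Relation.Binary.Structures using (IsEquivalence; IsStrictTotalOrder)
open import Relation.Nullary.Decidable using (_⊎-dec_; _×-dec_)
open import Relation.Unary using (Pred)

record OrderedGraph : Set₁ where
  field
    Vertex             : Set
    size               : ℕ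
    finite             : Vertex ↔ Fin size
    _≺_                : Rel Vertex 0ℓ
    isStrictTotalOrder : IsStrictTotalOrder _≡_ _≺_
    Adj                : Rel Vertex 0ℓ
    Adj?               : Decidable Adj
    Adj-sym            : Symmetric Adj
    Adj-irrefl         : Irreflexive _≡_ Adj

  vertices : List Vertex
  vertices = map (Inverse.from finite) (allFin size)

  degree : Vertex → ℕ
  degree v = length (filter (Adj? v) vertices)

  maxDegree : ℕ
  maxDegree = max 0 (map degree vertices)

open OrderedGraph public using (Vertex; size; maxDegree)

infix 4 _≅_ _⊑_

record _≅_ (G H : OrderedGraph) : Set where
  private
    module G = OrderedGraph G
    module H = OrderedGraph H
  field
    bijection : Vertex G ↔ Vertex H
  open Inverse bijection public using (to; from)
  field
    ≺-⇔   : ∀ u v → (u G.≺ v) ⇔ (to u H.≺ to v)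
    Adj-⇔ : ∀ u v → G.Adj u v ⇔ H.Adj (to u) (to v)

-- F ⊑ G: up to order-preserving isomorphism, F is a subgraph of G (not
-- necessarily induced), on a subset of the vertices with the induced order.
record _⊑_ (F G : OrderedGraph) : Set where
  private
    module F = OrderedGraph F
    module G = OrderedGraph G
  field
    to           : Vertex F → Vertex G
    to-injective : Injective _≡_ _≡_ to
    ≺-⇔          : ∀ u v → (u F.≺ v) ⇔ (to u G.≺ to v)
    Adj-⇒        : ∀ {u v} → F.Adj u v → G.Adj (to u) (to v)

private
  ⇔-from : ∀ {A B : Set} (f : A ↔ B) (R : Rel A 0ℓ) (S : Rel B 0ℓ) →
           (∀ u v → R u v ⇔ S (Inverse.to f u) (Inverse.to f v)) →
           ∀ x y → S x y ⇔ R (Inverse.from f x) (Inverse.from f y)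
  ⇔-from f R S e x y =
    ⇔-sym (subst₂ (λ a b → R (from x) (from y) ⇔ S a b)
                  (strictlyInverseˡ x) (strictlyInverseˡ y) (e (from x) (from y)))
    where open Inverse f

≅-isEquivalence : IsEquivalence _≅_
≅-isEquivalence = record
  { refl  = record { bijection = ↔-id _ ; ≺-⇔ = λ _ _ → ⇔-id _ ; Adj-⇔ = λ _ _ → ⇔-id _ }
  ; sym   = λ {G} {H} i → record
    { bijection = ↔-sym (_≅_.bijection i)
    ; ≺-⇔       = ⇔-from (_≅_.bijection i) (OrderedGraph._≺_ G) (OrderedGraph._≺_ H) (_≅_.≺-⇔ i)
    ; Adj-⇔     = ⇔-from (_≅_.bijection i) (OrderedGraph.Adj G) (OrderedGraph.Adj H) (_≅_.Adj-⇔ i)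
    }
  ; trans = λ i j → record
    { bijection = _≅_.bijection j ↔-∘ _≅_.bijection i
    ; ≺-⇔       = λ u v → _≅_.≺-⇔ j _ _ ⇔-∘ _≅_.≺-⇔ i u v
    ; Adj-⇔     = λ u v → _≅_.Adj-⇔ j _ _ ⇔-∘ _≅_.Adj-⇔ i u v
    }
  }

record IsMonotoneProperty {ℓ} (P : Pred OrderedGraph ℓ) : Set (lsuc 0ℓ ⊔ ℓ) where
  field
    respects-≅ : P Respects _≅_
    monotone   : ∀ {F G} → F ⊑ G → P G → P F

-- The graphs on n vertices in P, with isomorphism as equality: the elements
-- of this setoid are the members of 𝒫ₙ.
graphs : ∀ {ℓ} → Pred OrderedGraph ℓ → ℕ → Setoid (lsuc 0ℓ ⊔ ℓ) 0ℓ
graphs P n = record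
  { Carrier       = Σ OrderedGraph λ G → size G ≡ n × P G
  ; _≈_           = _≅_ on proj₁
  ; isEquivalence = On.isEquivalence proj₁ ≅-isEquivalence
  }

_⁽¹˒²⁾ : ∀ {ℓ} → Pred OrderedGraph ℓ → Pred OrderedGraph ℓ
(P ⁽¹˒²⁾) G = P G × maxDegree G ≤ 1

-- Since P need not be decidable, 𝒫ₙ need not constructively have a numerical
-- cardinality, so cardinalities are compared by injections and bijections.
infix 4 ∣_∣≤∣_∣ _≤∣_∣ ∣_∣≡_ _<∣_∣

∣_∣≤∣_∣ : ∀ {a b c d} → Setoid a b → Setoid c d → Set (a ⊔ b ⊔ c ⊔ d)
∣ A ∣≤∣ B ∣ = Injection A B

_≤∣_∣ : ∀ {a b} → ℕ → Setoid a b → Set (a ⊔ b)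
m ≤∣ A ∣ = Injection (setoid (Fin m)) A

∣_∣≡_ : ∀ {a b} → Setoid a b → ℕ → Set (a ⊔ b)
∣ A ∣≡ m = Inverse A (setoid (Fin m))

_<∣_∣ : ∀ {a b} → ℚ → Setoid a b → Set (a ⊔ b)
q <∣ A ∣ = ∃[ m ] (q ℚ.< + m ℚ./ 1) × (m ≤∣ A ∣)

HasSpeed : ∀ {ℓ} → Pred OrderedGraph ℓ → (ℕ → ℕ) → Set (lsuc 0ℓ ⊔ ℓ)
HasSpeed P f = ∀ n → ∣ graphs P n ∣≡ f n

-- |𝒫_N| > c^N for some N = N(c).  Restricting c to positive rationals loses
-- nothing: both this and the real version follow from the case of integers c,
-- as c ↦ c^N is monotone.
Superexponential : ∀ {ℓ} → Pred OrderedGraph ℓ → Set (lsuc 0ℓ ⊔ ℓ)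
Superexponential P = ∀ (c : ℚ) → 0ℚ ℚ.< c → ∃[ N ] (pow ℚ.+-*-rawSemiring c N <∣ graphs P N ∣)

module _ {k : ℕ} where
  private
    ↑ˡ≢↑ʳ : (i j : Fin k) → i ↑ˡ k ≢ k ↑ʳ j
    ↑ˡ≢↑ʳ i j eq with trans (sym (Fin.splitAt-↑ˡ k i k)) (trans (cong (Fin.splitAt k) eq) (Fin.splitAt-↑ʳ k k j))
    ... | ()

  -- (u , v) = (i , π(i) + k) for some i.
  Arc : Permutation′ k → Rel (Fin (k + k)) 0ℓ
  Arc π u v = ∃[ i ] (u ≡ i ↑ˡ k × v ≡ k ↑ʳ (π ⟨$⟩ʳ i))

  Arc? : ∀ π → Decidable (Arc π)
  Arc? π u v = Fin.any? λ i → (u Fin.≟ i ↑ˡ k) ×-dec (v Fin.≟ k ↑ʳ (π ⟨$⟩ʳ i))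

  Arc-irrefl : ∀ π → Irreflexive _≡_ (Arc π)
  Arc-irrefl π refl (i , p , q) = ↑ˡ≢↑ʳ i (π ⟨$⟩ʳ i) (trans (sym p) q)

  H : Permutation′ k → OrderedGraph
  H π = record
    { Vertex             = Fin (k + k)
    ; size               = k + k
    ; finite             = ↔-id _
    ; _≺_                = Fin._<_
    ; isStrictTotalOrder = Fin.<-isStrictTotalOrder
    ; Adj                = λ u v → Arc π u v ⊎ Arc π v u
    ; Adj?               = λ u v → Arc? π u v ⊎-dec Arc? π v u
    ; Adj-sym            = swap
    ; Adj-irrefl         = λ { eq (inj₁ a) → Arc-irrefl π eq a
                             ; eq (inj₂ a) → Arc-irrefl π (sym eq) a }
    }

minimalSpeed : ℕ → ℕ
minimalSpeed n = sum (map (λ k → (n C (2 * k)) * k !) (upTo (suc ⌊ n /2⌋)))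

-- f(n) = n^(n/2 + o(n)): for every ε = p/q > 0, eventually
--   n^((1/2 - ε) n) ≤ f(n) ≤ n^((1/2 + ε) n),
-- here raised to the power 2q and cleared of negative exponents.
IsHalfPower : (ℕ → ℕ) → Set
IsHalfPower f = ∀ p q → 0 < p → 0 < q → ∃[ n₀ ] ∀ n → n₀ ≤ n →
  (n ^ (q * n) ≤ f n ^ (2 * q) * n ^ (2 * p * n)) ×
  (f n ^ (2 * q) ≤ n ^ (q * n + 2 * p * n))

{-# OPTIONS --safe #-}
module Submission where

-- An ordered graph whose adjacency matrix (entries above the diagonal) contains the permutation
-- π with one more entry in the last row and first column contains H(π).  By Marcus–Tardos a
-- matrix avoiding a fixed permutation has O(n) ones.  Contracting s × s blocks preserves
-- avoidance, and the matrix is recovered from its contraction and s² bits for every one of the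
-- contraction; the geometric series of these costs encodes it in O(n) bits (Klazar).  So only
-- cⁿ graphs avoid H(π), and since containment is decidable a superexponential property yields
-- a member containing H(π).
--
-- The graphs contained in some H(π) are the matchings whose left endpoints precede all right
-- endpoints: on n vertices such a graph is given by its 2k endpoints and a permutation of [k].
-- Conversely such a matching on n vertices embeds in H(ι) for the involution ι exchanging
-- partners.  A property of the same speed contains all of them, and finiteness gives uniqueness.

-- Why π needs the additional entry: a vertex can serve both as a row and as a column, so a copy of
-- π alone may have its left ends interleaved with its right ends. The additional entry is an arc
-- from some u to some v. All rows of the pattern lie at or before u, all its columns at or after v,
-- and u < v, so every left end precedes every right end. Why n vertices go into H(ι) on 2n
-- vertices: no H(π) has isolated vertices, whereas a matching may have them between its endpoints.
-- Letting ι fix the isolated vertices gives each vertex a place on either side of the cut, whether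
-- or not an arc meets it.

open import Defs
import Algebra.Properties.CommutativeMonoid.Sum
import Algebra.Properties.Semiring.Sum
open import Algebra.Definitions.RawSemiring using () renaming (_^_ to pow)
open import Data.Bool.Base using (Bool; true; false; _∧_; if_then_else_)
import Data.Bool.Properties as Bool
open import Data.Fin.Base as Fin using (Fin; zero; suc; toℕ; fromℕ; fromℕ<; inject≤; splitAt; _↑ˡ_; _↑ʳ_; punchIn; punchOut; combine; remQuot; funToFin; finToFun)
open import Data.Fin.Permutation as Perm using (Permutation; Permutation′; permutation; _⟨$⟩ʳ_; _⟨$⟩ˡ_; flip; insert; remove; insert-punchIn; punchIn-permute; inverseˡ; inverseʳ)
import Data.Fin.Properties as Fin
open import Data.Integer.Base as ℤ using (+<+; +≤+)
import Data.Integer.Properties as ℤ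
open import Data.List.Base using (List; []; _∷_; _++_; allFin; applyUpTo; concat; length; tabulate)
open import Data.List.Extrema.Nat using (max≤v⁺)
import Data.List.Properties as List
open import Data.List.Relation.Unary.All as All using (All; []; _∷_)
import Data.List.Relation.Unary.All.Properties as All
open import Data.List.Relation.Unary.AllPairs using ([]; _∷_)
open import Data.List.Relation.Unary.Unique.Propositional using (Unique)
import Data.List.Relation.Unary.Unique.Propositional.Properties as Unique
open import Data.Nat.Base as ℕ using (ℕ; zero; suc; _+_; _*_; _^_; _≤_; _<_; z≤n; s≤s; s≤s⁻¹; _!; ⌊_/2⌋; NonZero)
open import Data.Nat.Combinatorics using (_C_; nCk+nC[k+1]≡[n+1]C[k+1])
import Data.Nat.Coprimality as Coprime
import Data.Nat.ListAction as ListAction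
import Data.Nat.Properties as ℕ
open import Data.Nat.Tactic.RingSolver using (solve-∀)
open import Data.Product using (Σ; ∃!; ∃₂; ∃-syntax; _×_; _,_; proj₁; proj₂; uncurry)
open import Data.Product.Properties using (,-injectiveʳ-UIP)
open import Data.Rational.Base as ℚ using (ℚ; 0ℚ; mkℚ; *<*; *≤*)
import Data.Rational.Properties as ℚ
open import Data.Sum.Base using (_⊎_; inj₁; inj₂; swap)
open import Data.Vec.Functional using () renaming (_++_ to _∥_)
open import Data.Vec.Functional.Properties using (lookup-++ˡ; lookup-++ʳ)
open import Function.Base using (_∘_; id)
open import Function.Bundles using (Inverse; Injection; Equivalence; _↔_; _⇔_; mk⇔; mk↔ₛ′)
open import Function.Construct.Composition using (_↔-∘_)
open import Function.Construct.Identity using (↔-id)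
open import Function.Construct.Symmetry using (↔-sym)
open import Function.Definitions using (Injective)
open import Level using (Level; 0ℓ; Lift; lift)
open import Relation.Binary.Core using (Rel; _Preserves_⟶_)
open import Relation.Binary.Definitions using (Decidable; tri<; tri≈; tri>)
open import Relation.Binary.PropositionalEquality using (_≡_; _≢_; _≗_; refl; sym; trans; cong; cong₂; subst; subst₂; module ≡-Reasoning)
open import Relation.Binary.Structures using (IsEquivalence; IsStrictTotalOrder)
open import Relation.Nullary using (¬_; Dec; yes; no; does; contradiction)
open import Relation.Nullary.Decidable using (dec-true; dec-false; map′; _×-dec_; _⊎-dec_; _→-dec_)
open import Relation.Unary using (Pred; _≐_; _⊆_)
open Algebra.Properties.CommutativeMonoid.Sum ℕ.+-0-commutativeMonoid using (sum; sum-syntax; sum-cong-≗; ∑-distrib-+; ∑-comm)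
open Algebra.Properties.Semiring.Sum ℕ.+-*-semiring using (*-distribˡ-sum; *-distribʳ-sum)

-- Finite sums

sum-mono : ∀ {n} {f g : Fin n → ℕ} → (∀ i → f i ≤ g i) → sum f ≤ sum g
sum-mono {zero}  f≤g = z≤n
sum-mono {suc n} f≤g = ℕ.+-mono-≤ (f≤g zero) (sum-mono (f≤g ∘ suc))

sum-≤-* : ∀ {n b} {f : Fin n → ℕ} → (∀ i → f i ≤ b) → sum f ≤ n * b
sum-≤-* {zero}  f≤b = z≤n
sum-≤-* {suc n} f≤b = ℕ.+-mono-≤ (f≤b zero) (sum-≤-* (f≤b ∘ suc))

term≤sum : ∀ {n} (f : Fin n → ℕ) i → f i ≤ sum f
term≤sum f zero    = ℕ.m≤m+n _ _
term≤sum f (suc i) = ℕ.≤-trans (term≤sum (f ∘ suc) i) (ℕ.m≤n+m _ _)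

sum-↑ : ∀ m {n} (f : Fin (m + n) → ℕ) → sum f ≡ sum (f ∘ (_↑ˡ n)) + sum (f ∘ (m ↑ʳ_))
sum-↑ zero    f = refl
sum-↑ (suc m) f = trans (cong (f zero +_) (sum-↑ m (f ∘ suc))) (sym (ℕ.+-assoc (f zero) _ _))

sum-combine : ∀ m n (f : Fin (m * n) → ℕ) → sum f ≡ ∑[ i < m ] ∑[ j < n ] f (combine i j)
sum-combine zero    n f = refl
sum-combine (suc m) n f = trans (sum-↑ n f) (cong (sum (f ∘ (_↑ˡ (m * n))) +_) (sum-combine m n (f ∘ (n ↑ʳ_))))

does⁻ : ∀ {A : Set} (A? : Dec A) → does A? ≡ true → A
does⁻ (yes a) _ = a

¬does⁻ : ∀ {A : Set} (A? : Dec A) → does A? ≡ false → ¬ A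
¬does⁻ (no ¬a) _ = ¬a

-- The Marcus–Tardos theorem

𝟙 : Bool → ℕ
𝟙 true  = 1
𝟙 false = 0

count : ∀ {n} → (Fin n → Bool) → ℕ
count p = sum (𝟙 ∘ p)

exists : ∀ {n} → (Fin n → Bool) → Bool
exists p = does (Fin.any? λ i → p i Bool.≟ true)

exists⁺ : ∀ {n} (p : Fin n → Bool) {i} → p i ≡ true → exists p ≡ true
exists⁺ p {i} pi = dec-true (Fin.any? λ i → p i Bool.≟ true) (i , pi)

exists⁻ : ∀ {n} (p : Fin n → Bool) → exists p ≡ true → ∃[ i ] p i ≡ true
exists⁻ p = does⁻ (Fin.any? λ i → p i Bool.≟ true)

exists-false : ∀ {n} (p : Fin n → Bool) → exists p ≡ false → ∀ i → p i ≡ false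
exists-false p e i = Bool.¬-not λ x → contradiction (trans (sym e) (exists⁺ p x)) λ ()

Matrix : ℕ → ℕ → Set
Matrix m n = Fin m → Fin n → Bool

ones : ∀ {m n} → Matrix m n → ℕ
ones M = sum (count ∘ M)

Increasing : ∀ {m n} → (Fin m → Fin n) → Set
Increasing f = f Preserves Fin._<_ ⟶ Fin._<_

select : ∀ {n} K (p : Fin n → Bool) → K ≤ count p →
         ∃[ g ] Increasing {K} g × ∀ i → p (g i) ≡ true
select {n}     zero    p K≤ = (λ ()) , (λ { {()} }) , λ ()
select {suc n} (suc K) p K≤ with p zero in p0
... | false = let g , g< , pg = select (suc K) (p ∘ suc) K≤ in suc ∘ g , s≤s ∘ g< , pg
... | true  = let g , g< , pg = select K (p ∘ suc) (s≤s⁻¹ K≤) in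
    (λ { zero → zero ; (suc i) → suc (g i) })
  , (λ { {zero} {suc j} _ → s≤s z≤n ; {suc i} {suc j} i<j → s≤s (g< (s≤s⁻¹ i<j)) })
  , λ { zero → p0 ; (suc i) → pg i }

record Contains {K m n} (σ : Permutation′ K) (M : Matrix m n) : Set where
  field
    row      : Fin K → Fin m
    col      : Fin K → Fin n
    row-incr : Increasing row
    col-incr : Increasing col
    entry    : ∀ i → M (row i) (col (σ ⟨$⟩ʳ i)) ≡ true

Contains-transpose : ∀ {K m n} {σ : Permutation′ K} {M : Matrix m n} →
                     Contains (flip σ) (λ j i → M i j) → Contains σ M
Contains-transpose {σ = σ} {M} C = record
  { row = col ; col = row ; row-incr = col-incr ; col-incr = row-incr
  ; entry = λ i → subst (λ j → M (col j) (row (σ ⟨$⟩ʳ i)) ≡ true) (inverseˡ σ) (entry (σ ⟨$⟩ʳ i)) }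
  where open Contains C

Contains-restrict : ∀ {K m n m′ n′} {σ : Permutation′ K} {M : Matrix m n}
                    {f : Fin m′ → Fin m} {g : Fin n′ → Fin n} → Increasing f → Increasing g →
                    Contains σ (λ i j → M (f i) (g j)) → Contains σ M
Contains-restrict {f = f} {g} f< g< C = record
  { row = f ∘ row ; col = g ∘ col ; row-incr = f< ∘ row-incr ; col-incr = g< ∘ col-incr ; entry = entry }
  where open Contains C

combine-monoʳ-< : ∀ {m n} (i : Fin m) → Increasing (combine {m} {n} i)
combine-monoʳ-< {m} {n} i {j} {l} j<l =
  subst₂ _<_ (sym (Fin.toℕ-combine i j)) (sym (Fin.toℕ-combine i l)) (ℕ.+-monoʳ-< (n * toℕ i) j<l)

block : ∀ n s → Matrix (n * s) (n * s) → Fin n → Fin n → Matrix s s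
block n s M i j r c = M (combine i r) (combine j c)

rowMask : ∀ {m n} → Matrix m n → Fin m → Bool
rowMask M r = exists (M r)

colMask : ∀ {m n} → Matrix m n → Fin n → Bool
colMask M c = exists (λ r → M r c)

contract : ∀ n s → Matrix (n * s) (n * s) → Matrix n n
contract n s M i j = exists (rowMask (block n s M i j))

-- A permutation uses each row and each column once, so the entries chosen inside different blocks
-- share no block row and no block column. The order of the blocks then decides the order of the
-- chosen lines, whatever the positions inside.
Contains-contract : ∀ {K} n s {σ : Permutation′ K} (M : Matrix (n * s) (n * s)) →
                    Contains σ (contract n s M) → Contains σ M
Contains-contract n s {σ} M C = record
  { row = λ i → combine (row i) (r i)
  ; col = λ j → combine (col j) (c j)
  ; row-incr = λ {i} {j} i<j → Fin.combine-monoˡ-< (r i) (r j) (row-incr i<j)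
  ; col-incr = λ {i} {j} i<j → Fin.combine-monoˡ-< (c i) (c j) (col-incr i<j)
  ; entry = λ i → subst (λ x → M (combine (row i) (r i)) (combine (col (σ ⟨$⟩ʳ i)) (c′ x)) ≡ true)
                        (sym (inverseˡ σ {i})) (c′-entry i) }
  where
  open Contains C
  cell : ∀ i → ∃[ x ] rowMask (block n s M (row i) (col (σ ⟨$⟩ʳ i))) x ≡ true
  cell i = exists⁻ (rowMask (block n s M (row i) (col (σ ⟨$⟩ʳ i)))) (entry i)
  r = λ i → proj₁ (cell i)
  cell′ : ∀ i → ∃[ y ] block n s M (row i) (col (σ ⟨$⟩ʳ i)) (r i) y ≡ true
  cell′ i = exists⁻ (block n s M (row i) (col (σ ⟨$⟩ʳ i)) (r i)) (proj₂ (cell i))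
  c′ = λ i → proj₁ (cell′ i)
  c′-entry = λ i → proj₂ (cell′ i)
  c = λ j → c′ (σ ⟨$⟩ˡ j)

maskIndex : ∀ {n} → (Fin n → Bool) → Fin (2 ^ n)
maskIndex p = funToFin (λ i → if p i then suc zero else zero)

maskIndex-injective : ∀ {n} (p q : Fin n → Bool) → maskIndex p ≡ maskIndex q → p ≗ q
maskIndex-injective p q eq i = ite (trans (sym (Fin.finToFun-funToFin _ i)) (trans (cong (λ x → finToFun x i) eq) (Fin.finToFun-funToFin _ i)))
  where
  ite : ∀ {a b : Bool} → (if a then suc {1} zero else zero) ≡ (if b then suc zero else zero) → a ≡ b
  ite {true}  {true}  _ = refl
  ite {false} {false} _ = refl
  ite {true}  {false} ()
  ite {false} {true}  ()

_∧[_≟_] : ∀ {n} → Bool → Fin n → Fin n → Bool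
b ∧[ x ≟ y ] = b ∧ does (x Fin.≟ y)

∧≟⁻ : ∀ {n} {b} {x y : Fin n} → b ∧[ x ≟ y ] ≡ true → b ≡ true × x ≡ y
∧≟⁻ {b = true} {x} {y} e = refl , does⁻ (x Fin.≟ y) e

𝟙≤∑∧≟ : ∀ {n} b (x : Fin n) → 𝟙 b ≤ ∑[ y < n ] 𝟙 (b ∧[ x ≟ y ])
𝟙≤∑∧≟ false x = z≤n
𝟙≤∑∧≟ true  x = ℕ.≤-trans (ℕ.≤-reflexive (cong 𝟙 (sym (dec-true (x Fin.≟ x) refl))))
  (term≤sum (λ y → 𝟙 (true ∧[ x ≟ y ])) x)

-- Double counting: the indices marked by `p` are sorted into the `N` fibres of `f`.
pigeonhole-count : ∀ {n N k} (p : Fin n → Bool) (f : Fin n → Fin N) →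
                   (∀ y → count (λ i → p i ∧[ f i ≟ y ]) ≤ k) → count p ≤ N * k
pigeonhole-count p f small = begin
  count p                                    ≤⟨ sum-mono (λ i → 𝟙≤∑∧≟ (p i) (f i)) ⟩
  sum (λ i → sum (λ y → 𝟙 (p i ∧[ f i ≟ y ]))) ≡⟨ ∑-comm (λ i y → 𝟙 (p i ∧[ f i ≟ y ])) ⟩
  sum (λ y → sum (λ i → 𝟙 (p i ∧[ f i ≟ y ]))) ≤⟨ sum-≤-* small ⟩
  _                                            ∎
  where open ℕ.≤-Reasoning

𝟙≤1 : ∀ b → 𝟙 b ≤ 1
𝟙≤1 true  = ℕ.≤-refl
𝟙≤1 false = z≤n

ones≤area : ∀ {m n} (M : Matrix m n) → ones M ≤ m * n
ones≤area {m} {n} M = sum-≤-* (λ i → ℕ.≤-trans (sum-≤-* (λ j → 𝟙≤1 (M i j))) (ℕ.≤-reflexive (ℕ.*-identityʳ n)))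

ones≤masks : ∀ {m n} (M : Matrix m n) → ones M ≤ count (rowMask M) * count (colMask M)
ones≤masks {m} {n} M = begin
  ones M ≤⟨ sum-mono (λ r → sum-mono (λ c → cell r c)) ⟩
  sum (λ r → sum (λ c → 𝟙 (rowMask M r) * 𝟙 (colMask M c)))
    ≡⟨ sum-cong-≗ (λ r → sym (*-distribˡ-sum (𝟙 (rowMask M r)) (𝟙 ∘ colMask M))) ⟩
  sum (λ r → 𝟙 (rowMask M r) * count (colMask M))
    ≡⟨ sym (*-distribʳ-sum (count (colMask M)) (𝟙 ∘ rowMask M)) ⟩
  count (rowMask M) * count (colMask M) ∎
  where
  open ℕ.≤-Reasoning
  cell : ∀ r c → 𝟙 (M r c) ≤ 𝟙 (rowMask M r) * 𝟙 (colMask M c)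
  cell r c with M r c in e
  ... | false = z≤n
  ... | true rewrite exists⁺ (M r) e | exists⁺ (λ r → M r c) e = ℕ.≤-refl

module _ {k : ℕ} where

  -- The pattern has size `suc k`, so a heavy mask marks enough lines to host all of it.
  heavy : ∀ {n} → (Fin n → Bool) → Bool
  heavy p = does (suc k ℕ.≤? count p)

  heavy⁻ : ∀ {n} (p : Fin n → Bool) → heavy p ≡ true → suc k ≤ count p
  heavy⁻ p = does⁻ (suc k ℕ.≤? count p)

  ¬heavy⁻ : ∀ {n} (p : Fin n → Bool) → heavy p ≡ false → count p ≤ k
  ¬heavy⁻ p e = s≤s⁻¹ (ℕ.≰⇒> (¬does⁻ (suc k ℕ.≤? count p) e))

  wide tall : ∀ {m n} → Matrix m n → Bool
  wide M = heavy (colMask M)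
  tall M = heavy (rowMask M)

  -- k + 1 wide blocks with the same nonzero columns in one block column
  -- contain every pattern of size k + 1.
  wide-count : ∀ n s {t} (σ : Permutation′ (suc k)) (M : Matrix (n * s) t) → ¬ Contains σ M →
               ∑[ i < n ] 𝟙 (wide (λ (r : Fin s) → M (combine i r))) ≤ 2 ^ t * k
  wide-count n s {t} σ M avoids = pigeonhole-count {n} isWide (maskIndex ∘ mask) small
    where
    _⊗_ : Fin n → Fin s → Fin (n * s)
    _⊗_ = combine
    mask : Fin n → Fin t → Bool
    mask i = colMask (λ r → M (i ⊗ r))
    isWide : Fin n → Bool
    isWide i = heavy (mask i)
    small : ∀ y → count (λ i → isWide i ∧[ maskIndex (mask i) ≟ y ]) ≤ k
    small y with suc k ℕ.≤? count (λ i → isWide i ∧[ maskIndex (mask i) ≟ y ])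
    ... | no ¬le = s≤s⁻¹ (ℕ.≰⇒> ¬le)
    ... | yes le = contradiction embedding avoids
      where
      chosen = select (suc k) (λ i → isWide i ∧[ maskIndex (mask i) ≟ y ]) le
      b = proj₁ chosen
      good : ∀ i → isWide (b i) ≡ true × maskIndex (mask (b i)) ≡ y
      good i = ∧≟⁻ (proj₂ (proj₂ chosen) i)
      columns = select (suc k) (mask (b zero)) (heavy⁻ (mask (b zero)) (proj₁ (good zero)))
      c = proj₁ columns
      hit : ∀ i j → ∃[ r ] M (b i ⊗ r) (c j) ≡ true
      hit i j = exists⁻ (λ r → M (b i ⊗ r) (c j))
        (trans (maskIndex-injective (mask (b i)) (mask (b zero))
                 (trans (proj₂ (good i)) (sym (proj₂ (good zero)))) (c j))
               (proj₂ (proj₂ columns) j))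
      embedding : Contains σ M
      embedding = record
        { row      = λ i → combine (b i) (proj₁ (hit i (σ ⟨$⟩ʳ i)))
        ; col      = c
        ; row-incr = λ {i} {j} i<j →
            Fin.combine-monoˡ-< (proj₁ (hit i (σ ⟨$⟩ʳ i))) (proj₁ (hit j (σ ⟨$⟩ʳ j))) (proj₁ (proj₂ chosen) i<j)
        ; col-incr = proj₁ (proj₂ columns)
        ; entry    = λ i → proj₂ (hit i (σ ⟨$⟩ʳ i)) }

  -- A block neither wide nor tall has at most `k` nonzero rows and `k` nonzero columns, whose
  -- crossings hold all its ones; if it is zero it has none. Any other block is charged its full
  -- area.
  ones-block : ∀ {s} (M : Matrix s s) →
               ones M ≤ k * k * 𝟙 (exists (rowMask M)) + s * s * (𝟙 (wide M) + 𝟙 (tall M))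
  ones-block {s} M with wide M in w | tall M in t
  ... | true  | b    = ℕ.≤-trans (ones≤area M) (ℕ.≤-trans (ℕ.m≤m*n (s * s) (suc (𝟙 b))) (ℕ.m≤n+m _ _))
  ... | false | true = ℕ.≤-trans (ones≤area M) (ℕ.≤-trans (ℕ.m≤m*n (s * s) 1) (ℕ.m≤n+m _ _))
  ... | false | false with exists (rowMask M) in e
  ...   | true  = ℕ.≤-trans (ones≤masks M) (ℕ.≤-trans (ℕ.*-mono-≤ (¬heavy⁻ (rowMask M) t) (¬heavy⁻ (colMask M) w))
                    (ℕ.≤-trans (ℕ.≤-reflexive (sym (ℕ.*-identityʳ (k * k)))) (ℕ.m≤m+n _ _)))
  ...   | false = ℕ.≤-trans (ones≤masks M) (ℕ.≤-trans (ℕ.*-monoˡ-≤ (count (colMask M)) noRows) z≤n)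
    where
    noRows : count (rowMask M) ≤ 0
    noRows = ℕ.≤-trans (sum-≤-* (λ r → ℕ.≤-reflexive (cong 𝟙 (exists-false (rowMask M) e r)))) (ℕ.≤-reflexive (ℕ.*-zeroʳ s))

  -- Summing the block bound leaves the wide and the tall blocks to be counted. The wide ones are
  -- bounded within each block column; transposition, with the inverse pattern, bounds the tall ones
  -- within each block row.
  ones-contract : ∀ n s (σ : Permutation′ (suc k)) (M : Matrix (n * s) (n * s)) → ¬ Contains σ M →
                  ones M ≤ k * k * ones (contract n s M) + s * s * (n * (2 ^ s * k) + n * (2 ^ s * k))
  ones-contract n s σ M avoids = begin
    ones M ≡⟨ sum-combine n s (count ∘ M) ⟩
    ∑[ i < n ] ∑[ r < s ] count (M (i ⊗ r))
      ≡⟨ sum-cong-≗ {n} (λ i → sum-cong-≗ {s} (λ r → sum-combine n s (𝟙 ∘ M (i ⊗ r)))) ⟩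
    ∑[ i < n ] ∑[ r < s ] ∑[ j < n ] count (block n s M i j r)
      ≡⟨ sum-cong-≗ {n} (λ i → ∑-comm {s} {n} (λ r j → count (block n s M i j r))) ⟩
    ∑[ i < n ] ∑[ j < n ] ones (block n s M i j)
      ≤⟨ sum-mono {n} (λ i → sum-mono {n} (λ j → ones-block (block n s M i j))) ⟩
    ∑[ i < n ] ∑[ j < n ] (k * k * B i j + s * s * (W i j + T i j))
      ≡⟨ linear ⟩
    k * k * ones (contract n s M) + s * s * (sum² W + sum² T)
      ≤⟨ ℕ.+-monoʳ-≤ (k * k * ones (contract n s M)) (ℕ.*-monoʳ-≤ (s * s) (ℕ.+-mono-≤ wides talls)) ⟩
    k * k * ones (contract n s M) + s * s * (n * (2 ^ s * k) + n * (2 ^ s * k)) ∎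
    where
    open ℕ.≤-Reasoning
    _⊗_ : Fin n → Fin s → Fin (n * s)
    _⊗_ = combine
    B W T : Fin n → Fin n → ℕ
    B i j = 𝟙 (contract n s M i j)
    W i j = 𝟙 (wide (block n s M i j))
    T i j = 𝟙 (tall (block n s M i j))
    sum² : (Fin n → Fin n → ℕ) → ℕ
    sum² f = sum (λ i → sum (f i))
    sum²-+ : ∀ f g → sum² (λ i j → f i j + g i j) ≡ sum² f + sum² g
    sum²-+ f g = trans (sum-cong-≗ (λ i → ∑-distrib-+ (f i) (g i))) (∑-distrib-+ (sum ∘ f) (sum ∘ g))
    sum²-* : ∀ a f → sum² (λ i j → a * f i j) ≡ a * sum² f
    sum²-* a f = trans (sum-cong-≗ (λ i → sym (*-distribˡ-sum a (f i)))) (sym (*-distribˡ-sum a (sum ∘ f)))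
    linear : sum² (λ i j → k * k * B i j + s * s * (W i j + T i j)) ≡ k * k * ones (contract n s M) + s * s * (sum² W + sum² T)
    linear = trans (sum²-+ (λ i j → k * k * B i j) (λ i j → s * s * (W i j + T i j)))
      (cong₂ _+_ (sum²-* (k * k) B)
                 (trans (sum²-* (s * s) (λ i j → W i j + T i j)) (cong (s * s *_) (sum²-+ W T))))
    wides : sum² W ≤ n * (2 ^ s * k)
    wides = ℕ.≤-trans (ℕ.≤-reflexive (∑-comm W)) (sum-≤-* λ j →
      wide-count n s σ (λ x c → M x (j ⊗ c)) (avoids ∘ Contains-restrict {M = M} (λ i<j → i<j) (combine-monoʳ-< j)))
    talls : sum² T ≤ n * (2 ^ s * k)
    talls = sum-≤-* λ i → wide-count n s (flip σ) (λ y r → M (i ⊗ r) y)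
      (avoids ∘ Contains-restrict {M = M} (combine-monoʳ-< i) (λ i<j → i<j) ∘ Contains-transpose)

  -- Since scale exceeds k², a bound f(scale n) ≤ k² f(n) + O(n) is solved by a linear f.
  scale : ℕ
  scale = 2 + k * k

  -- Powers of `scale` are contracted without remainder down to a single cell. Other sizes are
  -- padded to the next power.
  side : ℕ → ℕ
  side zero    = 1
  side (suc t) = side t * scale

  -- Since `scale` is 2 + k², the k² part of a step leaves a budget of `2 * density * side t`, which
  -- must cover the wide and the tall blocks. The product is their share; the 1 pays for the matrix
  -- with a single cell.
  density : ℕ
  density = 1 + scale * scale * (2 ^ scale * k)

  marcusTardos : ∀ t (σ : Permutation′ (suc k)) (M : Matrix (side t) (side t)) → ¬ Contains σ M →
                 ones M ≤ density * side t
  marcusTardos zero    σ M avoids = ℕ.≤-trans (ones≤area M) (s≤s z≤n)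
  marcusTardos (suc t) σ M avoids = begin
    ones M
      ≤⟨ ones-contract (side t) scale σ M avoids ⟩
    k * k * ones (contract (side t) scale M) + scale * scale * (side t * w + side t * w)
      ≤⟨ ℕ.+-monoˡ-≤ _ (ℕ.*-monoʳ-≤ (k * k) (marcusTardos t σ (contract (side t) scale M)
            (avoids ∘ Contains-contract (side t) scale M))) ⟩
    k * k * (density * side t) + scale * scale * (side t * w + side t * w)
      ≤⟨ ℕ.m≤m+n _ (2 * side t) ⟩
    k * k * (density * side t) + scale * scale * (side t * w + side t * w) + 2 * side t
      ≡⟨ arith (k * k) (scale * scale) (side t) w ⟩
    density * (side t * scale) ∎
    where
    open ℕ.≤-Reasoning
    w = 2 ^ scale * k
    arith : ∀ q z n w → q * ((1 + z * w) * n) + z * (n * w + n * w) + 2 * n ≡ (1 + z * w) * (n * (2 + q))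
    arith = solve-∀

-- Row and column maps are searched through their codes in `Fin (m ^ K)` and `Fin (n ^ K)`. A
-- decoded map agrees with the original one pointwise, hence the transports.
Contains? : ∀ {K m n} (σ : Permutation′ K) (M : Matrix m n) → Dec (Contains σ M)
Contains? {K} {m} {n} σ M =
  map′ fromSearch toSearch (Fin.any? λ x → Fin.any? λ y → occurs? (finToFun x) (finToFun y))
  where
  Incr : ∀ {n} → (Fin K → Fin n) → Set
  Incr f = ∀ i j → i Fin.< j → f i Fin.< f j
  Occurs : (Fin K → Fin m) → (Fin K → Fin n) → Set
  Occurs r c = Incr r × Incr c × ∀ i → M (r i) (c (σ ⟨$⟩ʳ i)) ≡ true
  incr? : ∀ {n} (f : Fin K → Fin n) → Dec (Incr f)
  incr? f = Fin.all? λ i → Fin.all? λ j → (i Fin.<? j) →-dec (f i Fin.<? f j)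
  occurs? : ∀ r c → Dec (Occurs r c)
  occurs? r c = incr? r ×-dec incr? c ×-dec Fin.all? λ i → M (r i) (c (σ ⟨$⟩ʳ i)) Bool.≟ true
  fromSearch : (∃[ x ] ∃[ y ] Occurs (finToFun x) (finToFun y)) → Contains σ M
  fromSearch (x , y , r< , c< , e) = record
    { row = finToFun x ; col = finToFun y
    ; row-incr = λ {i} {j} → r< i j ; col-incr = λ {i} {j} → c< i j ; entry = e }
  toSearch : Contains σ M → ∃[ x ] ∃[ y ] Occurs (finToFun x) (finToFun y)
  toSearch C = funToFin row , funToFin col
    , (λ i j i<j → subst₂ Fin._<_ (sym (r≗ i)) (sym (r≗ j)) (row-incr i<j))
    , (λ i j i<j → subst₂ Fin._<_ (sym (c≗ i)) (sym (c≗ j)) (col-incr i<j))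
    , λ i → trans (cong₂ M (r≗ i) (c≗ (σ ⟨$⟩ʳ i))) (entry i)
    where
    open Contains C
    r≗ : finToFun (funToFin row) ≗ row
    r≗ = Fin.finToFun-funToFin row
    c≗ : finToFun (funToFin col) ≗ col
    c≗ = Fin.finToFun-funToFin col

-- Counting pattern-avoiding matrices

++-cancel-length : ∀ (as bs : List Bool) {xs ys} → length as ≡ length bs →
                   as ++ xs ≡ bs ++ ys → as ≡ bs × xs ≡ ys
++-cancel-length []       []       _   eq = refl , eq
++-cancel-length (a ∷ as) (b ∷ bs) len eq =
  let a≡b , eq′ = List.∷-injective eq
      as≡bs , xs≡ys = ++-cancel-length as bs (ℕ.suc-injective len) eq′
  in cong₂ _∷_ a≡b as≡bs , xs≡ys

chunks : ∀ {n} → (Fin n → List Bool) → List Bool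
chunks f = concat (tabulate f)

length-chunks : ∀ {n} (f : Fin n → List Bool) → length (chunks f) ≡ sum (length ∘ f)
length-chunks {zero}  f = refl
length-chunks {suc n} f = trans (List.length-++ (f zero)) (cong (length (f zero) +_) (length-chunks (f ∘ suc)))

-- No separators are stored: equal lengths tell where to cut. The tails `xs` and `ys` allow words to
-- be nested and followed by others.
chunks-cancel : ∀ {n} (f g : Fin n → List Bool) → (∀ i → length (f i) ≡ length (g i)) →
                ∀ {xs ys} → chunks f ++ xs ≡ chunks g ++ ys → f ≗ g × xs ≡ ys
chunks-cancel {zero}  f g len eq = (λ ()) , eq
chunks-cancel {suc n} f g len {xs} {ys} eq =
  let f₀≡g₀ , eq′ = ++-cancel-length (f zero) (g zero) (len zero)
        (trans (sym (List.++-assoc (f zero) (chunks (f ∘ suc)) xs)) (trans eq (List.++-assoc (g zero) (chunks (g ∘ suc)) ys)))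
      f≗g , xs≡ys = chunks-cancel (f ∘ suc) (g ∘ suc) (len ∘ suc) eq′
  in (λ { zero → f₀≡g₀ ; (suc i) → f≗g i }) , xs≡ys

chunks-injective : ∀ {n} (f g : Fin n → List Bool) → (∀ i → length (f i) ≡ length (g i)) →
                   chunks f ≡ chunks g → f ≗ g
chunks-injective f g len eq = proj₁ (chunks-cancel f g len (cong (_++ []) eq))

length-chunks-≡ : ∀ {n} (f g : Fin n → List Bool) → (∀ i → length (f i) ≡ length (g i)) →
                  length (chunks f) ≡ length (chunks g)
length-chunks-≡ f g len = trans (length-chunks f) (trans (sum-cong-≗ len) (sym (length-chunks g)))

entries : ∀ {m n} → Matrix m n → List Bool
entries M = chunks λ r → chunks λ c → M r c ∷ []

length-entries : ∀ {m n} (M N : Matrix m n) → length (entries M) ≡ length (entries N)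
length-entries M N = length-chunks-≡ _ _ λ r → length-chunks-≡ (λ c → M r c ∷ []) (λ c → N r c ∷ []) λ c → refl

length-entries-≤ : ∀ {m n} (M : Matrix m n) → length (entries M) ≤ m * n
length-entries-≤ {m} {n} M = begin
  length (entries M)     ≡⟨ length-chunks {m} (λ r → chunks λ c → M r c ∷ []) ⟩
  _                      ≤⟨ sum-≤-* (λ r → ℕ.≤-trans (ℕ.≤-reflexive (length-chunks (λ c → M r c ∷ [])))
                              (sum-≤-* {n} {1} (λ c → ℕ.≤-refl))) ⟩
  m * (n * 1)            ≡⟨ cong (m *_) (ℕ.*-identityʳ n) ⟩
  m * n                  ∎
  where open ℕ.≤-Reasoning

entries-injective : ∀ {m n} (M N : Matrix m n) → entries M ≡ entries N → ∀ r c → M r c ≡ N r c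
entries-injective M N eq r c = List.∷-injectiveˡ (chunks-injective _ _ (λ _ → refl)
  (chunks-injective _ _ (λ r → length-chunks-≡ (λ c → M r c ∷ []) (λ c → N r c ∷ []) λ c → refl) eq r) c)

if-[] : Bool → List Bool → List Bool
if-[] b xs = if b then xs else []

details : ∀ n s → Matrix (n * s) (n * s) → Fin n → Fin n → List Bool
details n s M i j = if-[] (contract n s M i j) (entries (block n s M i j))

details-injective : ∀ n s (M N : Matrix (n * s) (n * s)) →
  (∀ i j → contract n s M i j ≡ contract n s N i j) → (∀ i j → details n s M i j ≡ details n s N i j) →
  ∀ x y → M x y ≡ N x y
details-injective n s M N B≡ eq x y with Fin.combine-surjective {n} {s} x | Fin.combine-surjective {n} {s} y
... | i , r , refl | j , c , refl with contract n s M i j in p | contract n s N i j in q | B≡ i j | eq i j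
...   | true  | true  | _ | e = entries-injective (block n s M i j) (block n s N i j) e r c
...   | false | false | _ | _ = trans (empty M p) (sym (empty N q))
  where
  empty : ∀ M → contract n s M i j ≡ false → block n s M i j r c ≡ false
  empty M p = exists-false (block n s M i j r) (exists-false (rowMask (block n s M i j)) p r) c

-- The contraction alone fixes these lengths, so once it has been decoded the details can be cut
-- apart.
length-details : ∀ n s (M N : Matrix (n * s) (n * s)) →
  (∀ i j → contract n s M i j ≡ contract n s N i j) →
  ∀ i j → length (details n s M i j) ≡ length (details n s N i j)
length-details n s M N B≡ i j rewrite B≡ i j with contract n s N i j
... | true  = length-entries (block n s M i j) (block n s N i j)
... | false = refl

length-details-≤ : ∀ n s M i j → length (details n s M i j) ≤ s * s * 𝟙 (contract n s M i j)
length-details-≤ n s M i j with contract n s M i j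
... | true  = ℕ.≤-trans (length-entries-≤ (block n s M i j)) (ℕ.≤-reflexive (sym (ℕ.*-identityʳ (s * s))))
... | false = z≤n

-- With digits 1 and 2 in place of 0 and 1, words of different lengths get different values.
numeral : List Bool → ℕ
numeral []       = 0
numeral (b ∷ bs) = suc (𝟙 b + 2 * numeral bs)

numeral-injective : ∀ as bs → numeral as ≡ numeral bs → as ≡ bs
numeral-injective []           []           _  = refl
numeral-injective (true ∷ as)  (true ∷ bs)  eq =
  cong (true ∷_) (numeral-injective as bs (ℕ.*-cancelˡ-≡ _ _ 2 (ℕ.suc-injective (ℕ.suc-injective eq))))
numeral-injective (false ∷ as) (false ∷ bs) eq =
  cong (false ∷_) (numeral-injective as bs (ℕ.*-cancelˡ-≡ _ _ 2 (ℕ.suc-injective eq)))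
numeral-injective (true ∷ as)  (false ∷ bs) eq = contradiction (sym (ℕ.suc-injective eq)) (ℕ.even≢odd (numeral bs) (numeral as))
numeral-injective (false ∷ as) (true ∷ bs)  eq = contradiction (ℕ.suc-injective eq) (ℕ.even≢odd (numeral as) (numeral bs))

-- The largest numeral of a word of length L has all digits 2 and equals 2^(L+1) - 2. Adding 2 makes
-- the bound double exactly with each digit.
numeral-bound : ∀ bs → 2 + numeral bs ≤ 2 ^ suc (length bs)
numeral-bound []       = ℕ.≤-refl
numeral-bound (b ∷ bs) = begin
  3 + (𝟙 b + 2 * numeral bs)  ≤⟨ ℕ.+-monoʳ-≤ 3 (ℕ.+-monoˡ-≤ (2 * numeral bs) (𝟙≤1 b)) ⟩
  4 + 2 * numeral bs          ≡⟨ sym (ℕ.*-distribˡ-+ 2 2 (numeral bs)) ⟩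
  2 * (2 + numeral bs)        ≤⟨ ℕ.*-monoʳ-≤ 2 (numeral-bound bs) ⟩
  2 ^ suc (suc (length bs))   ∎
  where
  open ℕ.≤-Reasoning

-- The 1 added to the exponent, which the numerals cost, is absorbed by one additional bit for each
-- of the `n` ≥ 1 vertices.
2^-bound : ∀ E s S n → 1 ≤ n → S ≤ n * s → 2 ^ suc (E * S) ≤ (2 ^ suc (E * s)) ^ n
2^-bound E s S n 1≤n S≤n*s = begin
  2 ^ suc (E * S)         ≤⟨ ℕ.^-monoʳ-≤ 2 (ℕ.+-mono-≤ 1≤n (ℕ.*-monoʳ-≤ E S≤n*s)) ⟩
  2 ^ (n + E * (n * s))   ≡⟨ cong (2 ^_) (arith E s n) ⟩
  2 ^ (suc (E * s) * n)   ≡⟨ sym (ℕ.^-*-assoc 2 (suc (E * s)) n) ⟩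
  (2 ^ suc (E * s)) ^ n   ∎
  where
  open ℕ.≤-Reasoning
  arith : ∀ E s n → n + E * (n * s) ≡ suc (E * s) * n
  arith = solve-∀

module _ {k : ℕ} where
  private
    s = scale {k}
    D = density {k}

  encode : ∀ t → Matrix (side {k} t) (side {k} t) → List Bool
  encode zero    M = M zero zero ∷ []
  encode (suc t) M = encode t (contract (side {k} t) s M) ++ chunks λ i → chunks λ j → details (side {k} t) s M i j

  -- Codes of different matrices may differ in length, so injectivity is strengthened to unique
  -- decoding in front of any tail. The contraction is decoded first, and it fixes the lengths of
  -- the details behind it.
  encode-cancel : ∀ t (M N : Matrix (side {k} t) (side {k} t)) {xs ys} → encode t M ++ xs ≡ encode t N ++ ys →
                  (∀ x y → M x y ≡ N x y) × xs ≡ ys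
  encode-cancel zero M N eq with List.∷-injective eq
  ... | e , xs≡ys = (λ { zero zero → e }) , xs≡ys
  encode-cancel (suc t) M N {xs} {ys} eq =
    details-injective n s M N B≡
      (λ i → chunks-injective (dM i) (dN i) (length-details n s M N B≡ i) (rows i))
    , xs≡ys
    where
    n = side {k} t
    dM dN : Fin n → Fin n → List Bool
    dM i j = details n s M i j
    dN i j = details n s N i j
    outer = encode-cancel t (contract n s M) (contract n s N)
      (trans (sym (List.++-assoc (encode t (contract n s M)) _ xs)) (trans eq (List.++-assoc (encode t (contract n s N)) _ ys)))
    B≡ = proj₁ outer
    inner = chunks-cancel (chunks ∘ dM) (chunks ∘ dN)
      (λ i → length-chunks-≡ (dM i) (dN i) (length-details n s M N B≡ i)) (proj₂ outer)
    rows = proj₁ inner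
    xs≡ys = proj₂ inner

  encode-injective : ∀ t (M N : Matrix (side {k} t) (side {k} t)) → encode t M ≡ encode t N → ∀ x y → M x y ≡ N x y
  encode-injective t M N eq = proj₁ (encode-cancel t M N (cong (_++ []) eq))

  -- The geometric series, as an induction: the code of the contraction and the details each take at
  -- most `s * s * D * n` bits, the latter by Marcus-Tardos for the contraction. Since `s` is 2 +
  -- k², both fit into `s * s * D` times the next side.
  length-encode : ∀ t (σ : Permutation′ (suc k)) (M : Matrix (side {k} t) (side {k} t)) → ¬ Contains σ M →
                  length (encode t M) ≤ s * s * D * side {k} t
  length-encode zero    σ M avoids = s≤s z≤n
  length-encode (suc t) σ M avoids = begin
    length (encode (suc t) M)
      ≡⟨ List.length-++ (encode t B) ⟩
    length (encode t B) + length (chunks λ i → chunks λ j → details n s M i j)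
      ≤⟨ ℕ.+-mono-≤ (length-encode t σ B avoids′) detailLength ⟩
    s * s * D * n + s * s * (D * n)
      ≤⟨ ℕ.m≤m+n _ (k * k * (s * s * D * n)) ⟩
    s * s * D * n + s * s * (D * n) + k * k * (s * s * D * n)
      ≡⟨ arith (s * s) D n (k * k) ⟩
    s * s * D * (n * s) ∎
    where
    open ℕ.≤-Reasoning
    n = side {k} t
    B = contract n s M
    avoids′ : ¬ Contains σ B
    avoids′ = avoids ∘ Contains-contract n s M
    arith : ∀ z d n q → z * d * n + z * (d * n) + q * (z * d * n) ≡ z * d * (n * (2 + q))
    arith = solve-∀
    detailLength : length (chunks λ i → chunks λ j → details n s M i j) ≤ s * s * (D * n)
    detailLength = begin
      length (chunks λ i → chunks λ j → details n s M i j)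
        ≡⟨ length-chunks (λ i → chunks λ j → details n s M i j) ⟩
      ∑[ i < n ] length (chunks λ j → details n s M i j)
        ≡⟨ sum-cong-≗ {n} (λ i → length-chunks (λ j → details n s M i j)) ⟩
      ∑[ i < n ] ∑[ j < n ] length (details n s M i j)
        ≤⟨ sum-mono {n} (λ i → sum-mono {n} (λ j → length-details-≤ n s M i j)) ⟩
      ∑[ i < n ] ∑[ j < n ] (s * s * 𝟙 (B i j))
        ≡⟨ sum-cong-≗ {n} (λ i → sym (*-distribˡ-sum (s * s) (𝟙 ∘ B i))) ⟩
      ∑[ i < n ] (s * s * count (B i))
        ≡⟨ sym (*-distribˡ-sum (s * s) (count ∘ B)) ⟩
      s * s * ones B
        ≤⟨ ℕ.*-monoʳ-≤ (s * s) (marcusTardos t σ B avoids′) ⟩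
      s * s * (D * n) ∎

  -- Padding to a power of `scale` enlarges the side by at most the factor `s`, so a bound
  -- exponential in the side is still exponential in `n`.
  side-between : ∀ n → 1 ≤ n → ∃[ t ] n ≤ side {k} t × side {k} t ≤ n * s
  side-between 1             _ = 0 , ℕ.≤-refl , s≤s z≤n
  side-between (suc (suc n)) _ with side-between (suc n) (s≤s z≤n)
  ... | t , lo , hi with suc (suc n) ℕ.≤? side {k} t
  ...   | yes le = t , le , ℕ.≤-trans hi (ℕ.m≤n+m _ s)
  ...   | no ¬le =
      suc t , ℕ.≤-trans (s≤s lo) (double (side {k} t) (ℕ.≤-trans (s≤s z≤n) lo)) , ℕ.*-monoˡ-≤ s (ℕ.<⇒≤ (ℕ.≰⇒> ¬le))
    where
    double : ∀ a → 1 ≤ a → suc a ≤ a * s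
    double a 1≤a = ℕ.≤-trans (ℕ.+-monoˡ-≤ a 1≤a)
      (ℕ.≤-trans (ℕ.≤-reflexive (trans (cong (a +_) (sym (ℕ.+-identityʳ a))) (ℕ.*-comm 2 a))) (ℕ.*-monoʳ-≤ a (s≤s (s≤s z≤n))))

  avoiding-count : ∀ t (σ : Permutation′ (suc k)) {m} (F : Fin m → Matrix (side {k} t) (side {k} t)) →
                   (∀ i → ¬ Contains σ (F i)) → (∀ i j → (∀ x y → F i x y ≡ F j x y) → i ≡ j) →
                   m ≤ 2 ^ suc (s * s * D * side {k} t)
  avoiding-count t σ {m} F avoids distinct =
    Fin.injective⇒≤ {f = λ i → fromℕ< (bounded i)}
      λ {i} {j} eq → distinct i j (encode-injective t (F i) (F j)
        (numeral-injective _ _ (Fin.fromℕ<-injective _ _ (bounded i) (bounded j) eq)))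
    where
    bounded : ∀ i → numeral (encode t (F i)) < 2 ^ suc (s * s * D * side {k} t)
    bounded i = ℕ.≤-trans (ℕ.n≤1+n _)
      (ℕ.≤-trans (numeral-bound (encode t (F i))) (ℕ.^-monoʳ-≤ 2 (s≤s (length-encode t σ (F i) (avoids i)))))

  abstract
    -- The exponent counts bits per vertex: `s * s * D` per unit of side, times `s` for the padding,
    -- and one for the numeral.
    growth : ℕ
    growth = 2 ^ suc (s * s * D * s)

    growth>0 : 0 < growth
    growth>0 = ℕ.m^n>0 2 (suc (s * s * D * s))

    avoiding-few : ∀ t n (σ : Permutation′ (suc k)) → 1 ≤ n → side {k} t ≤ n * s →
                   ∀ {m} (F : Fin m → Matrix (side {k} t) (side {k} t)) →
                   (∀ i → ¬ Contains σ (F i)) → (∀ i j → (∀ x y → F i x y ≡ F j x y) → i ≡ j) →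
                   m ≤ growth ^ n
    avoiding-few t n σ 1≤n le F avoids distinct =
      ℕ.≤-trans (avoiding-count t σ F avoids distinct) (2^-bound (s * s * D) s (side {k} t) n 1≤n le)

module ≅ = IsEquivalence ≅-isEquivalence

-- Increasing maps

increasing⇒injective : ∀ {m n} {f : Fin m → Fin n} → Increasing f → Injective _≡_ _≡_ f
increasing⇒injective f< {i} {j} eq with Fin.<-cmp i j
... | tri< i<j _ _ = contradiction eq (Fin.<⇒≢ (f< i<j))
... | tri≈ _ i≡j _ = i≡j
... | tri> _ _ j<i = contradiction (sym eq) (Fin.<⇒≢ (f< j<i))

increasing-cancel : ∀ {m n} {f : Fin m → Fin n} → Increasing f → ∀ {i j} → f i Fin.< f j → i Fin.< j
increasing-cancel f< {i} {j} lt with Fin.<-cmp i j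
... | tri< i<j _ _ = i<j
... | tri≈ _ i≡j _ = contradiction (cong _ i≡j) (Fin.<⇒≢ lt)
... | tri> _ _ j<i = contradiction lt (ℕ.<-asym (f< j<i))

increasing-⇔ : ∀ {m n} {f : Fin m → Fin n} → Increasing f → ∀ i j → (i Fin.< j) ⇔ (f i Fin.< f j)
increasing-⇔ f< i j = mk⇔ f< (increasing-cancel f<)

increasing-≥ : ∀ {m n} {f : Fin m → Fin n} d → Increasing f → (∀ i → d ≤ toℕ (f i)) → ∀ i → d + toℕ i ≤ toℕ (f i)
increasing-≥ d f< d≤ zero    = subst (_≤ _) (sym (ℕ.+-identityʳ d)) (d≤ zero)
increasing-≥ {f = f} d f< d≤ (suc i) = subst (_≤ toℕ (f (suc i))) (sym (ℕ.+-suc d (toℕ i)))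
  (increasing-≥ {f = f ∘ suc} (suc d) (f< ∘ s≤s) (λ j → ℕ.≤-trans (s≤s (d≤ zero)) (f< (s≤s z≤n))) i)

-- Finite chains are rigid: an increasing self-map moves no point down, so `i` ≤ `f i` ≤ `g (f i)` =
-- `i`.
increasing-inverse⇒id : ∀ {n} {f g : Fin n → Fin n} → Increasing f → Increasing g → (∀ i → g (f i) ≡ i) → ∀ i → f i ≡ i
increasing-inverse⇒id {f = f} {g} f< g< gf i = Fin.toℕ-injective (ℕ.≤-antisym
  (subst (λ x → toℕ (f i) ≤ toℕ x) (gf i) (increasing-≥ {f = g} 0 g< (λ _ → z≤n) (f i)))
  (increasing-≥ {f = f} 0 f< (λ _ → z≤n) i))

∥-increasing : ∀ {k l n} {f : Fin k → Fin n} {g : Fin l → Fin n} → Increasing f → Increasing g →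
               (∀ i j → f i Fin.< g j) → Increasing (f ∥ g)
∥-increasing {k} {l} {f = f} {g} f< g< f<g {x} {y} x<y with splitAt k x in p | splitAt k y in q
... | inj₁ i | inj₁ j = f< (subst₂ _<_ (Fin.toℕ-↑ˡ i l) (Fin.toℕ-↑ˡ j l)
                              (subst₂ Fin._<_ (sym (Fin.splitAt⁻¹-↑ˡ p)) (sym (Fin.splitAt⁻¹-↑ˡ q)) x<y))
... | inj₁ i | inj₂ j = f<g i j
... | inj₂ i | inj₂ j = g< (ℕ.+-cancelˡ-< k _ _ (subst₂ _<_ (Fin.toℕ-↑ʳ k i) (Fin.toℕ-↑ʳ k j)
                              (subst₂ Fin._<_ (sym (Fin.splitAt⁻¹-↑ʳ {m = k} p)) (sym (Fin.splitAt⁻¹-↑ʳ {m = k} q)) x<y)))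
... | inj₂ i | inj₁ j = contradiction x<y (ℕ.≤⇒≯ (ℕ.≤-trans (ℕ.<⇒≤ y<k) k≤x))
  where
  y<k : toℕ y < k
  y<k = subst (_< k) (trans (sym (Fin.toℕ-↑ˡ j l)) (cong toℕ (Fin.splitAt⁻¹-↑ˡ q))) (Fin.toℕ<n j)
  k≤x : k ≤ toℕ x
  k≤x = subst (k ≤_) (trans (sym (Fin.toℕ-↑ʳ k i)) (cong toℕ (Fin.splitAt⁻¹-↑ʳ {m = k} p))) (ℕ.m≤m+n k (toℕ i))

-- A missed value could be punched out, leaving an injection of `Fin (suc n)` into `Fin n`.
injective⇒surjective : ∀ {n} {f : Fin n → Fin n} → Injective _≡_ _≡_ f → ∀ y → ∃[ x ] f x ≡ y
injective⇒surjective {suc n} {f} f-inj y with Fin.any? (λ x → f x Fin.≟ y)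
... | yes hit = hit
... | no miss = contradiction (Fin.injective⇒≤ {f = λ x → punchOut (avoid x)}
                  (λ {i} {j} → f-inj ∘ Fin.punchOut-injective (avoid i) (avoid j))) (ℕ.<⇒≱ ℕ.≤-refl)
  where
  avoid : ∀ x → y ≢ f x
  avoid x eq = miss (x , sym eq)

-- Ordered graphs on Fin n

-- Each edge is kept once, directed from its smaller to its larger end. On `Fin n` isomorphism then
-- amounts to equivalence of the arc relations.
record Arcs (n : ℕ) : Set₁ where
  field
    _⟶_ : Rel (Fin n) 0ℓ
    _⟶?_ : Decidable _⟶_
    ⟶⇒< : ∀ {u v} → u ⟶ v → u Fin.< v

  graph : OrderedGraph
  graph = record
    { Vertex             = Fin n
    ; size               = n
    ; finite             = ↔-id _
    ; _≺_                = Fin._<_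
    ; isStrictTotalOrder = Fin.<-isStrictTotalOrder
    ; Adj                = λ u v → u ⟶ v ⊎ v ⟶ u
    ; Adj?               = λ u v → (u ⟶? v) ⊎-dec (v ⟶? u)
    ; Adj-sym            = swap
    ; Adj-irrefl         = λ { refl (inj₁ a) → ℕ.<-irrefl refl (⟶⇒< a)
                             ; refl (inj₂ a) → ℕ.<-irrefl refl (⟶⇒< a) }
    }

open Arcs using (graph)

module _ {n : ℕ} (A B : Arcs n) where
  private
    module A = Arcs A
    module B = Arcs B

  graph-≅ : (∀ u v → (u A.⟶ v) ⇔ (u B.⟶ v)) → graph A ≅ graph B
  graph-≅ e = record
    { bijection = ↔-id _
    ; ≺-⇔       = λ u v → mk⇔ id id
    ; Adj-⇔     = λ u v → mk⇔
        (λ { (inj₁ a) → inj₁ (Equivalence.to (e u v) a) ; (inj₂ a) → inj₂ (Equivalence.to (e v u) a) })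
        (λ { (inj₁ a) → inj₁ (Equivalence.from (e u v) a) ; (inj₂ a) → inj₂ (Equivalence.from (e v u) a) })
    }

  -- By rigidity the isomorphism fixes every vertex; it cannot reverse an arc because it preserves
  -- the order.
  ≅⇒⟶ : graph A ≅ graph B → ∀ {u v} → u A.⟶ v → u B.⟶ v
  ≅⇒⟶ i {u} {v} a with Equivalence.to (Adj-⇔ u v) (inj₁ a)
    where open _≅_ i
  ... | inj₁ b = subst₂ B._⟶_ (fixed u) (fixed v) b
    where
    open _≅_ i
    fixed : ∀ w → to w ≡ w
    fixed = increasing-inverse⇒id (λ {x} {y} → Equivalence.to (≺-⇔ x y))
      (λ {x} {y} x<y → Equivalence.from (≺-⇔ (from x) (from y))
        (subst₂ Fin._<_ (sym (Inverse.strictlyInverseˡ bijection x)) (sym (Inverse.strictlyInverseˡ bijection y)) x<y))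
      (Inverse.strictlyInverseʳ bijection)
  ... | inj₂ b = contradiction (Equivalence.to (≺-⇔ u v) (A.⟶⇒< a)) (ℕ.<-asym (B.⟶⇒< b))
    where open _≅_ i

count-mono-< : ∀ {n} (p q : Fin n → Bool) → (∀ i → p i ≡ true → q i ≡ true) →
               ∀ j → p j ≡ false → q j ≡ true → count p < count q
count-mono-< {suc n} p q p⇒q j pj qj = go j pj qj
  where
  𝟙-mono : ∀ i → 𝟙 (p i) ≤ 𝟙 (q i)
  𝟙-mono i with p i in e
  ... | false = z≤n
  ... | true rewrite p⇒q i e = ℕ.≤-refl
  go : ∀ j → p j ≡ false → q j ≡ true → count p < count q
  go zero    pj qj rewrite pj | qj = s≤s (sum-mono (𝟙-mono ∘ suc))
  go (suc j) pj qj = ℕ.+-mono-≤-< (𝟙-mono zero) (count-mono-< (p ∘ suc) (q ∘ suc) (p⇒q ∘ suc) j pj qj)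

count≤n : ∀ {n} (p : Fin n → Bool) → count p ≤ n
count≤n {n} p = subst (count p ≤_) (ℕ.*-identityʳ n) (sum-≤-* (𝟙≤1 ∘ p))

module _ (G : OrderedGraph) where
  private
    module G = OrderedGraph G
    module O = IsStrictTotalOrder G.isStrictTotalOrder
    open Inverse G.finite using () renaming (to to index; from to vertex; strictlyInverseˡ to index-vertex; strictlyInverseʳ to vertex-index)

    below : Vertex G → Fin (size G) → Bool
    below v i = does (vertex i O.<? v)

    below-self : ∀ {u v} → ¬ (u G.≺ v) → below v (index u) ≡ false
    below-self {u} {v} ¬lt = dec-false (vertex (index u) O.<? v) (¬lt ∘ subst (G._≺ v) (vertex-index u))

    rank-bound : ∀ v → count (below v) < size G
    rank-bound v = ℕ.<-≤-trans
      (count-mono-< (below v) (λ _ → true) (λ _ _ → refl) (index v) (below-self (O.irrefl refl)) refl)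
      (count≤n (λ _ → true))

  -- The bijection `finite` need not respect the order, so each vertex is renumbered by how many lie
  -- below it.
  rank : Vertex G → Fin (size G)
  rank v = fromℕ< (rank-bound v)

  rank-mono : ∀ {u v} → u G.≺ v → rank u Fin.< rank v
  rank-mono {u} {v} u≺v = subst₂ _<_ (sym (Fin.toℕ-fromℕ< (rank-bound u))) (sym (Fin.toℕ-fromℕ< (rank-bound v)))
    (count-mono-< (below u) (below v)
      (λ i e → dec-true (vertex i O.<? v) (O.trans (does⁻ (vertex i O.<? u) e) u≺v))
      (index u) (below-self (O.irrefl refl))
      (dec-true (vertex (index u) O.<? v) (subst (G._≺ v) (sym (vertex-index u)) u≺v)))

  rank-cancel : ∀ {u v} → rank u Fin.< rank v → u G.≺ v
  rank-cancel {u} {v} lt with O.compare u v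
  ... | tri< u≺v _ _ = u≺v
  ... | tri≈ _ refl _ = contradiction lt (ℕ.<-irrefl refl)
  ... | tri> _ _ v≺u = contradiction lt (ℕ.<-asym (rank-mono v≺u))

  rank-injective : Injective _≡_ _≡_ rank
  rank-injective {u} {v} eq with O.compare u v
  ... | tri< u≺v _ _ = contradiction eq (Fin.<⇒≢ (rank-mono u≺v))
  ... | tri≈ _ u≡v _ = u≡v
  ... | tri> _ _ v≺u = contradiction (sym eq) (Fin.<⇒≢ (rank-mono v≺u))

  private
    unrank : ∀ i → ∃[ x ] rank (vertex x) ≡ i
    unrank = injective⇒surjective λ {x} {y} eq →
      trans (sym (index-vertex x)) (trans (cong index (rank-injective eq)) (index-vertex y))

  nth : Fin (size G) → Vertex G
  nth i = vertex (proj₁ (unrank i))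

  rank-nth : ∀ i → rank (nth i) ≡ i
  rank-nth i = proj₂ (unrank i)

  nth-rank : ∀ v → nth (rank v) ≡ v
  nth-rank v = rank-injective (rank-nth (rank v))

  nth-mono : ∀ {i j} → i Fin.< j → nth i G.≺ nth j
  nth-mono lt = rank-cancel (subst₂ Fin._<_ (sym (rank-nth _)) (sym (rank-nth _)) lt)

  nth-cancel : ∀ {i j} → nth i G.≺ nth j → i Fin.< j
  nth-cancel lt = subst₂ Fin._<_ (rank-nth _) (rank-nth _) (rank-mono lt)

  arcs : Arcs (size G)
  arcs = record
    { _⟶_  = λ u v → u Fin.< v × G.Adj (nth u) (nth v)
    ; _⟶?_ = λ u v → (u Fin.<? v) ×-dec G.Adj? (nth u) (nth v)
    ; ⟶⇒<  = proj₁
    }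

  canonical : graph arcs ≅ G
  canonical = record
    { bijection = mk↔ₛ′ nth rank nth-rank rank-nth
    ; ≺-⇔       = λ u v → mk⇔ nth-mono nth-cancel
    ; Adj-⇔     = λ u v → mk⇔ (λ { (inj₁ (_ , a)) → a ; (inj₂ (_ , a)) → G.Adj-sym a }) (adj u v)
    }
    where
    adj : ∀ u v → G.Adj (nth u) (nth v) → Arcs._⟶_ arcs u v ⊎ Arcs._⟶_ arcs v u
    adj u v a with Fin.<-cmp u v
    ... | tri< u<v _ _ = inj₁ (u<v , a)
    ... | tri≈ _ refl _ = contradiction a (G.Adj-irrefl refl)
    ... | tri> _ _ v<u = inj₂ (v<u , G.Adj-sym a)

≅⇒⊑ : ∀ {F G} → F ≅ G → F ⊑ G
≅⇒⊑ i = record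
  { to = to
  ; to-injective = λ eq →
      trans (sym (Inverse.strictlyInverseʳ bijection _)) (trans (cong from eq) (Inverse.strictlyInverseʳ bijection _))
  ; ≺-⇔ = ≺-⇔ ; Adj-⇒ = λ {u} {v} → Equivalence.to (Adj-⇔ u v) }
  where open _≅_ i

⊑-trans : ∀ {E F G} → E ⊑ F → F ⊑ G → E ⊑ G
⊑-trans i j = record
  { to = J.to ∘ I.to ; to-injective = I.to-injective ∘ J.to-injective
  ; ≺-⇔ = λ u v → mk⇔ (Equivalence.to (J.≺-⇔ _ _) ∘ Equivalence.to (I.≺-⇔ u v))
                       (Equivalence.from (I.≺-⇔ u v) ∘ Equivalence.from (J.≺-⇔ _ _))
  ; Adj-⇒ = J.Adj-⇒ ∘ I.Adj-⇒ }
  where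
  module I = _⊑_ i
  module J = _⊑_ j

-- From matrices to ordered graphs

module _ {n : ℕ} (S : ℕ) (A : Arcs n) where
  open Arcs A

  -- Vertices and indices are compared as numbers, so for `S` above `n` the matrix is padded with
  -- zero rows and columns.
  Entry : Fin S → Fin S → Set
  Entry x y = ∃[ u ] ∃[ v ] toℕ u ≡ toℕ x × toℕ v ≡ toℕ y × u ⟶ v

  entry? : Decidable Entry
  entry? x y = Fin.any? λ u → Fin.any? λ v → (toℕ u ℕ.≟ toℕ x) ×-dec (toℕ v ℕ.≟ toℕ y) ×-dec (u ⟶? v)

  adjacency : Matrix S S
  adjacency x y = does (entry? x y)

  adjacency⁻ : ∀ {x y} → adjacency x y ≡ true → Entry x y
  adjacency⁻ {x} {y} = does⁻ (entry? x y)

  adjacency⁺ : ∀ {x y} → Entry x y → adjacency x y ≡ true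
  adjacency⁺ {x} {y} = dec-true (entry? x y)

adjacency-injective : ∀ {n S} → n ≤ S → (A B : Arcs n) → (∀ x y → adjacency S A x y ≡ adjacency S B x y) →
                      ∀ {u v} → Arcs._⟶_ A u v → Arcs._⟶_ B u v
adjacency-injective {n} {S} n≤S A B eq {u} {v} a =
  let u′ , v′ , p , q , b = adjacency⁻ S B (trans (sym (eq _ _)) (adjacency⁺ S A (_ , _ , inj u , inj v , a)))
  in subst₂ (Arcs._⟶_ B) (Fin.toℕ-injective (trans p (sym (inj u)))) (Fin.toℕ-injective (trans q (sym (inj v)))) b
  where
  inj : ∀ w → toℕ w ≡ toℕ (inject≤ w n≤S)
  inj w = sym (Fin.toℕ-inject≤ w n≤S)

insert-self : ∀ {m n} i j (π : Permutation m n) → insert i j π ⟨$⟩ʳ i ≡ j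
insert-self i j π with i Fin.≟ i
... | yes _ = refl
... | no ≢  = contradiction refl ≢

-- π with an additional entry in the last row and first column: in a matrix of
-- increasing arcs it forces the other rows to lie before the other columns.
separated : ∀ {k} → Permutation′ k → Permutation′ (suc k)
separated {k} π = insert (fromℕ k) zero π

punchIn-increasing : ∀ {n} (i : Fin (suc n)) → Increasing (punchIn i)
punchIn-increasing i {j} {l} j<l = Fin.≤∧≢⇒< (Fin.punchIn-mono-≤ i j l (ℕ.<⇒≤ j<l)) (Fin.<⇒≢ j<l ∘ Fin.punchIn-injective i j l)

H⊑graph : ∀ {n k} (A : Arcs n) (π : Permutation′ k) (l r : Fin k → Fin n) → Increasing l → Increasing r →
          (∀ i j → l i Fin.< r j) → (∀ i → Arcs._⟶_ A (l i) (r (π ⟨$⟩ʳ i))) → H π ⊑ graph A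
H⊑graph {k = k} A π l r l< r< l<r arc = record
  { to           = l ∥ r
  ; to-injective = increasing⇒injective incr
  ; ≺-⇔          = increasing-⇔ incr
  ; Adj-⇒        = λ { (inj₁ a) → inj₁ (image a) ; (inj₂ a) → inj₂ (image a) } }
  where
  incr : Increasing (l ∥ r)
  incr = ∥-increasing l< r< l<r
  image : ∀ {u v} → Arc π u v → Arcs._⟶_ A ((l ∥ r) u) ((l ∥ r) v)
  image (i , refl , refl) = subst₂ (Arcs._⟶_ A) (sym (lookup-++ˡ l r i)) (sym (lookup-++ʳ l r (π ⟨$⟩ʳ i))) (arc i)

Contains⇒H⊑ : ∀ {n k} S (A : Arcs n) (π : Permutation′ k) → Contains (separated π) (adjacency S A) → H π ⊑ graph A
Contains⇒H⊑ {n} {k} S A π C = H⊑graph A π l r l< r< l<r arc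
  where
  open Contains C
  open Arcs A
  last = fromℕ k
  hit : ∀ i → Entry S A (row (punchIn last i)) (col (suc (π ⟨$⟩ʳ i)))
  hit i = adjacency⁻ S A (subst (λ j → adjacency S A (row (punchIn last i)) (col j) ≡ true)
                                (insert-punchIn last zero π i) (entry (punchIn last i)))
  corner : Entry S A (row last) (col zero)
  corner = adjacency⁻ S A (subst (λ j → adjacency S A (row last) (col j) ≡ true) (insert-self last zero π) (entry last))
  l r r′ : Fin k → Fin n
  l i = proj₁ (hit i)
  r′ i = proj₁ (proj₂ (hit i))
  -- The entries come indexed by rows; indexing the right ends by columns lets `col-incr` order
  -- them.
  r j = r′ (π ⟨$⟩ˡ j)
  l≡ : ∀ i → toℕ (l i) ≡ toℕ (row (punchIn last i))
  l≡ i = proj₁ (proj₂ (proj₂ (hit i)))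
  r≡ : ∀ j → toℕ (r j) ≡ toℕ (col (suc j))
  r≡ j = trans (proj₁ (proj₂ (proj₂ (proj₂ (hit (π ⟨$⟩ˡ j)))))) (cong (toℕ ∘ col ∘ suc) (inverseʳ π))
  l< : Increasing l
  l< {i} {j} i<j = subst₂ _<_ (sym (l≡ i)) (sym (l≡ j)) (row-incr (punchIn-increasing last i<j))
  r< : Increasing r
  r< {i} {j} i<j = subst₂ _<_ (sym (r≡ i)) (sym (r≡ j)) (col-incr (s≤s i<j))
  l<r : ∀ i j → l i Fin.< r j
  l<r i j = let u , v , p , q , a = corner in begin-strict
    toℕ (l i)                    ≡⟨ l≡ i ⟩
    toℕ (row (punchIn last i))   <⟨ row-incr (Fin.≤∧≢⇒< (Fin.≤fromℕ _) (Fin.punchInᵢ≢i last i)) ⟩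
    toℕ (row last)               ≡⟨ sym p ⟩
    toℕ u                        <⟨ ⟶⇒< a ⟩
    toℕ v                        ≡⟨ q ⟩
    toℕ (col zero)               <⟨ col-incr {zero} {suc j} (s≤s z≤n) ⟩
    toℕ (col (suc j))            ≡⟨ sym (r≡ j) ⟩
    toℕ (r j)                    ∎
    where open ℕ.≤-Reasoning
  arc : ∀ i → l i ⟶ r (π ⟨$⟩ʳ i)
  arc i = subst (λ x → l i ⟶ r′ x) (sym (inverseˡ π {i})) (proj₂ (proj₂ (proj₂ (proj₂ (hit i)))))

-- Exponential growth with rational and with natural bases

fromℕℚ : ℕ → ℚ
fromℕℚ a = mkℚ (ℤ.+ a) 0 (Coprime.sym (Coprime.1-coprimeTo a))

/1≡fromℕℚ : ∀ a → ℤ.+ a ℚ./ 1 ≡ fromℕℚ a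
/1≡fromℕℚ a = ℚ.normalize-coprime (Coprime.sym (Coprime.1-coprimeTo a))

fromℕℚ-mono-< : ∀ {a b} → a < b → fromℕℚ a ℚ.< fromℕℚ b
fromℕℚ-mono-< {a} {b} a<b = *<* (subst₂ ℤ._<_ (sym (ℤ.*-identityʳ (ℤ.+ a))) (sym (ℤ.*-identityʳ (ℤ.+ b))) (+<+ a<b))

fromℕℚ-cancel-< : ∀ {a b} → fromℕℚ a ℚ.< fromℕℚ b → a < b
fromℕℚ-cancel-< {a} {b} (*<* lt) = ℤ.drop‿+<+ (subst₂ ℤ._<_ (ℤ.*-identityʳ (ℤ.+ a)) (ℤ.*-identityʳ (ℤ.+ b)) lt)

infixr 8 _^ℚ_
_^ℚ_ : ℚ → ℕ → ℚ
_^ℚ_ = pow ℚ.+-*-rawSemiring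

fromℕℚ-^ : ∀ a n → fromℕℚ a ^ℚ n ≡ fromℕℚ (a ^ n)
fromℕℚ-^ a zero    = /1≡fromℕℚ 1
fromℕℚ-^ a (suc n) = begin
  fromℕℚ a ℚ.* fromℕℚ a ^ℚ n       ≡⟨ cong (fromℕℚ a ℚ.*_) (fromℕℚ-^ a n) ⟩
  (ℤ.+ a ℤ.* ℤ.+ (a ^ n)) ℚ./ 1        ≡⟨ cong (ℚ._/ 1) (sym (ℤ.pos-* a (a ^ n))) ⟩
  ℤ.+ (a * a ^ n) ℚ./ 1              ≡⟨ /1≡fromℕℚ (a * a ^ n) ⟩
  fromℕℚ (a * a ^ n)               ∎
  where open ≡-Reasoning

Superexponentialℕ : ∀ {ℓ} → Pred OrderedGraph ℓ → Set _
Superexponentialℕ P = ∀ a → 0 < a → ∃[ N ] ∃[ m ] a ^ N < m × m ≤∣ graphs P N ∣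

superexponential⇒ℕ : ∀ {ℓ} {P : Pred OrderedGraph ℓ} → Superexponential P → Superexponentialℕ P
superexponential⇒ℕ S a 0<a =
  let N , m , lt , inj = S (fromℕℚ a) (fromℕℚ-mono-< 0<a)
  in N , m , fromℕℚ-cancel-< (subst₂ ℚ._<_ (fromℕℚ-^ a N) (/1≡fromℕℚ m) lt) , inj

^ℚ-mono-≤ : ∀ {p q} → 0ℚ ℚ.≤ p → p ℚ.≤ q → ∀ n → 0ℚ ℚ.≤ p ^ℚ n × p ^ℚ n ℚ.≤ q ^ℚ n
^ℚ-mono-≤ 0≤p p≤q zero = ℚ.nonNegative⁻¹ _ , ℚ.≤-refl
^ℚ-mono-≤ {p} {q} 0≤p p≤q (suc n) =
  let 0≤pⁿ , pⁿ≤qⁿ = ^ℚ-mono-≤ 0≤p p≤q n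
      instance
        p≥0 = ℚ.nonNegative 0≤p
        q≥0 = ℚ.nonNegative (ℚ.≤-trans 0≤p p≤q)
        pⁿ≥0 = ℚ.nonNegative 0≤pⁿ
  in subst (ℚ._≤ p ℚ.* p ^ℚ n) (ℚ.*-zeroʳ p) (ℚ.*-monoˡ-≤-nonNeg p 0≤pⁿ)
   , ℚ.≤-trans (ℚ.*-monoʳ-≤-nonNeg (p ^ℚ n) p≤q) (ℚ.*-monoˡ-≤-nonNeg q pⁿ≤qⁿ)

≤fromℕℚ : ∀ (c : ℚ) → 0ℚ ℚ.< c → ∃[ a ] c ℚ.≤ fromℕℚ a
≤fromℕℚ (mkℚ (ℤ.+ a) d _) _ = a , *≤* (ℤ.*-monoˡ-≤-nonNeg (ℤ.+ a) (+≤+ (s≤s z≤n)))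
≤fromℕℚ (mkℚ (ℤ.-[1+ a ]) d _) (*<* ())

ℕ⇒superexponential : ∀ {ℓ} {P : Pred OrderedGraph ℓ} → Superexponentialℕ P → Superexponential P
ℕ⇒superexponential S c 0<c =
  let a , c≤a = ≤fromℕℚ c 0<c
      N , m , lt , inj = S (suc a) (s≤s z≤n)
      c≤1+a = ℚ.≤-trans c≤a (ℚ.<⇒≤ (fromℕℚ-mono-< (ℕ.n<1+n a)))
  in N , m , ℚ.≤-<-trans (proj₂ (^ℚ-mono-≤ (ℚ.<⇒≤ 0<c) c≤1+a N))
       (subst₂ ℚ._<_ (sym (fromℕℚ-^ (suc a) N)) (sym (/1≡fromℕℚ m)) (fromℕℚ-mono-< lt)) , inj

-- Finding H(π) in a superexponential property

arcsOf : ∀ {n} (G : OrderedGraph) → size G ≡ n → Arcs n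
arcsOf G refl = arcs G

arcsOf-≅ : ∀ {n} G (eq : size G ≡ n) → graph (arcsOf G eq) ≅ G
arcsOf-≅ G refl = canonical G

module _ {ℓ : Level} {P : Pred OrderedGraph ℓ} {n : ℕ} where

  arcsAt : ∀ {m} → m ≤∣ graphs P n ∣ → Fin m → Arcs n
  arcsAt I i = let G , eq , _ = Injection.to I i in arcsOf G eq

  arcsAt-∈ : ∀ {m} → IsMonotoneProperty P → (I : m ≤∣ graphs P n ∣) → ∀ i → P (graph (arcsAt I i))
  arcsAt-∈ mono I i = let G , eq , p = Injection.to I i in
    IsMonotoneProperty.respects-≅ mono (≅.sym (arcsOf-≅ G eq)) p

  arcsAt-injective : ∀ {m} (I : m ≤∣ graphs P n ∣) → ∀ {i j} →
    (∀ u v → Arcs._⟶_ (arcsAt I i) u v ⇔ Arcs._⟶_ (arcsAt I j) u v) → i ≡ j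
  arcsAt-injective I {i} {j} e = let G , p , _ = Injection.to I i ; G′ , p′ , _ = Injection.to I j in
    Injection.injective I (≅.trans (≅.sym (arcsOf-≅ G p)) (≅.trans (graph-≅ (arcsAt I i) (arcsAt I j) e) (arcsOf-≅ G′ p′)))

module _ {ℓ : Level} {P : Pred OrderedGraph ℓ} (mono : IsMonotoneProperty P) where

  -- Assuming that `P` omits `H π` would only refute the omission, as `P` need not be decidable.
  -- Testing each of the `m` given members instead either exhibits `H π` or shows that all of them
  -- avoid the pattern.
  H-or-few : ∀ {k} (π : Permutation′ k) n {m} (I : m ≤∣ graphs P n ∣) → P (H π) ⊎ m ≤ growth {k} ^ n
  -- The counting bound needs `n` ≥ 1. On no vertices there is one graph at most, and `growth ^ 0`
  -- is 1.
  H-or-few {k} π zero I = inj₂ (atMostOne _ I)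
    where
    atMostOne : ∀ m → m ≤∣ graphs P 0 ∣ → m ≤ 1
    atMostOne zero          I = z≤n
    atMostOne (suc zero)    I = ℕ.≤-refl
    atMostOne (suc (suc m)) I with () ← arcsAt-injective I {zero} {suc zero} (λ ())
  H-or-few {k} π n@(suc _) {m} I with side-between {k} n (s≤s z≤n)
  ... | t , n≤S , S≤n*s with Fin.any? (λ i → Contains? (separated π) (adjacency (side {k} t) (arcsAt I i)))
  ...   | yes (i , C) = inj₁ (IsMonotoneProperty.monotone mono (Contains⇒H⊑ (side {k} t) (arcsAt I i) π C) (arcsAt-∈ mono I i))
  ...   | no none = inj₂ (avoiding-few t n (separated π) (s≤s z≤n) S≤n*s
      (adjacency (side {k} t) ∘ arcsAt I) (λ i C → none (i , C))
      λ i j eq → arcsAt-injective I λ u v → mk⇔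
        (adjacency-injective n≤S (arcsAt I i) (arcsAt I j) eq)
        (adjacency-injective n≤S (arcsAt I j) (arcsAt I i) (λ x y → sym (eq x y))))

  superexponential⇒H : Superexponential P → ∀ k (π : Permutation′ k) → P (H π)
  superexponential⇒H S k π with superexponential⇒ℕ S (growth {k}) (growth>0 {k})
  ... | N , m , lt , I with H-or-few π N I
  ...   | inj₁ h  = h
  ...   | inj₂ le = contradiction lt (ℕ.≤⇒≯ le)

-- Asymptotics of the minimal speed

sum-applyUpTo : ∀ (f : ℕ → ℕ) m → ListAction.sum (applyUpTo f m) ≡ ∑[ k < m ] f (toℕ k)
sum-applyUpTo f zero    = refl
sum-applyUpTo f (suc m) = cong (f 0 +_) (sum-applyUpTo (f ∘ suc) m)

minimalSpeed-∑ : ∀ n → minimalSpeed n ≡ ∑[ k < suc ⌊ n /2⌋ ] ((n C (2 * toℕ k)) * toℕ k !)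
minimalSpeed-∑ n = trans (cong ListAction.sum (List.map-upTo (λ k → (n C (2 * k)) * k !) (suc ⌊ n /2⌋)))
                         (sum-applyUpTo (λ k → (n C (2 * k)) * k !) (suc ⌊ n /2⌋))

nCk≤2^n : ∀ n k → n C k ≤ 2 ^ n
nCk≤2^n zero    zero    = ℕ.≤-refl
nCk≤2^n zero    (suc k) = z≤n
nCk≤2^n (suc n) zero    = ℕ.m^n>0 2 (suc n)
nCk≤2^n (suc n) (suc k) = subst (_≤ 2 ^ suc n) (nCk+nC[k+1]≡[n+1]C[k+1] n k)
  (ℕ.+-mono-≤ (nCk≤2^n n k) (ℕ.≤-trans (nCk≤2^n n (suc k)) (ℕ.m≤m+n (2 ^ n) 0)))

nCk>0 : ∀ {n k} → k ≤ n → 1 ≤ n C k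
nCk>0 {k = zero}      z≤n       = ℕ.≤-refl
nCk>0 {suc n} {suc k} (s≤s k≤n) = subst (1 ≤_) (nCk+nC[k+1]≡[n+1]C[k+1] n k) (ℕ.≤-trans (nCk>0 k≤n) (ℕ.m≤m+n _ _))

n!>0 : ∀ n → 1 ≤ n !
n!>0 zero    = ℕ.≤-refl
n!>0 (suc n) = ℕ.≤-trans (n!>0 n) (ℕ.m≤m+n (n !) (n * n !))

!-mono : ∀ {m n} → m ≤ n → m ! ≤ n !
!-mono {n = n} z≤n = n!>0 n
!-mono (s≤s m≤n)   = ℕ.*-mono-≤ (s≤s m≤n) (!-mono m≤n)

n!≤n^n : ∀ {m n} → m ≤ n → m ! ≤ n ^ m
n!≤n^n {zero}  _   = ℕ.≤-refl
n!≤n^n {suc m} m<n = ℕ.*-mono-≤ m<n (n!≤n^n (ℕ.<⇒≤ m<n))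

-- This bounds a binomial coefficient by `2 ^ (m + n)`, cleared of division; the induction is
-- Pascal's rule.
[m+n]!≤ : ∀ m n → (m + n) ! ≤ 2 ^ (m + n) * (m ! * n !)
[m+n]!≤ zero    n = ℕ.≤-trans
  (ℕ.≤-reflexive (trans (sym (ℕ.*-identityˡ (n !))) (cong (1 *_) (sym (ℕ.+-identityʳ (n !))))))
  (ℕ.*-monoˡ-≤ _ (ℕ.m^n>0 2 n))
[m+n]!≤ (suc m) zero = subst₂ (λ a b → a ! ≤ 2 ^ a * b) (sym (ℕ.+-identityʳ (suc m))) (sym (ℕ.*-identityʳ (suc m !)))
  (ℕ.≤-trans (ℕ.≤-reflexive (sym (ℕ.*-identityˡ (suc m !)))) (ℕ.*-monoˡ-≤ (suc m !) (ℕ.m^n>0 2 (suc m))))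
[m+n]!≤ (suc m) (suc n) = begin
  (suc m + suc n) !
    ≡⟨ ℕ.*-distribʳ-+ ((m + suc n) !) (suc m) (suc n) ⟩
  suc m * (m + suc n) ! + suc n * (m + suc n) !
    ≤⟨ ℕ.+-mono-≤ (ℕ.*-monoʳ-≤ (suc m) ([m+n]!≤ m (suc n)))
                  (ℕ.*-monoʳ-≤ (suc n) (subst (λ a → a ! ≤ 2 ^ a * (suc m ! * n !)) (sym (ℕ.+-suc m n)) ([m+n]!≤ (suc m) n))) ⟩
  suc m * (2 ^ (m + suc n) * (m ! * suc n !)) + suc n * (2 ^ (m + suc n) * (suc m ! * n !))
    ≡⟨ arith (suc m) (suc n) (2 ^ (m + suc n)) (m !) (n !) ⟩
  2 * 2 ^ (m + suc n) * (suc m ! * suc n !) ∎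
  where
  open ℕ.≤-Reasoning
  arith : ∀ a b p x y → a * (p * (x * (b * y))) + b * (p * ((a * x) * y)) ≡ 2 * p * ((a * x) * (b * y))
  arith = solve-∀

m!*m^n≤[n+m]! : ∀ m n → m ! * m ^ n ≤ (n + m) !
m!*m^n≤[n+m]! m zero    = ℕ.≤-reflexive (ℕ.*-identityʳ (m !))
m!*m^n≤[n+m]! m (suc n) = begin
  m ! * (m * m ^ n)     ≡⟨ arith (m !) m (m ^ n) ⟩
  m * (m ! * m ^ n)     ≤⟨ ℕ.*-mono-≤ (ℕ.≤-trans (ℕ.m≤n+m m n) (ℕ.n≤1+n (n + m))) (m!*m^n≤[n+m]! m n) ⟩
  suc (n + m) * (n + m) ! ∎
  where
  open ℕ.≤-Reasoning
  arith : ∀ a b c → a * (b * c) ≡ b * (a * c)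
  arith = solve-∀

-- k! k^k ≤ (2k)! ≤ 4^k k! k!
n^n≤4^n*n! : ∀ n → n ^ n ≤ 4 ^ n * n !
n^n≤4^n*n! n = ℕ.*-cancelˡ-≤ (n !) {{ℕ.>-nonZero (n!>0 n)}} (begin
  n ! * n ^ n                  ≤⟨ m!*m^n≤[n+m]! n n ⟩
  (n + n) !                    ≤⟨ [m+n]!≤ n n ⟩
  2 ^ (n + n) * (n ! * n !)    ≡⟨ cong (_* (n ! * n !)) (trans (cong (2 ^_) (arith′ n)) (sym (ℕ.^-*-assoc 2 2 n))) ⟩
  4 ^ n * (n ! * n !)          ≡⟨ arith (4 ^ n) (n !) ⟩
  n ! * (4 ^ n * n !)          ∎)
  where
  open ℕ.≤-Reasoning
  arith : ∀ a b → a * (b * b) ≡ b * (a * b)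
  arith = solve-∀
  arith′ : ∀ n → n + n ≡ 2 * n
  arith′ = solve-∀

n<2^n : ∀ n → suc n ≤ 2 ^ n
n<2^n zero    = ℕ.≤-refl
n<2^n (suc n) = ℕ.≤-trans (ℕ.+-mono-≤ (ℕ.m^n>0 2 n) (n<2^n n)) (ℕ.≤-reflexive (cong (2 ^ n +_) (sym (ℕ.+-identityʳ (2 ^ n)))))

^-distribʳ-* : ∀ a b n → (a * b) ^ n ≡ a ^ n * b ^ n
^-distribʳ-* a b zero    = refl
^-distribʳ-* a b (suc n) = trans (cong (a * b *_) (^-distribʳ-* a b n)) (arith a b (a ^ n) (b ^ n))
  where
  arith : ∀ a b c d → a * b * (c * d) ≡ a * c * (b * d)
  arith = solve-∀

minimalSpeed-≤ : ∀ n → minimalSpeed n ≤ 4 ^ n * n ^ ⌊ n /2⌋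
minimalSpeed-≤ n = begin
  minimalSpeed n                     ≡⟨ minimalSpeed-∑ n ⟩
  ∑[ k < suc h ] ((n C (2 * toℕ k)) * toℕ k !)
    ≤⟨ sum-≤-* {suc h} (λ k → ℕ.*-mono-≤ (nCk≤2^n n (2 * toℕ k))
        (ℕ.≤-trans (!-mono (s≤s⁻¹ (Fin.toℕ<n k))) (n!≤n^n (ℕ.⌊n/2⌋≤n n)))) ⟩
  suc h * (2 ^ n * n ^ h)            ≤⟨ ℕ.*-monoˡ-≤ (2 ^ n * n ^ h) (ℕ.≤-trans (s≤s (ℕ.⌊n/2⌋≤n n)) (n<2^n n)) ⟩
  2 ^ n * (2 ^ n * n ^ h)            ≡⟨ sym (ℕ.*-assoc (2 ^ n) (2 ^ n) (n ^ h)) ⟩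
  2 ^ n * 2 ^ n * n ^ h              ≡⟨ cong (_* n ^ h) (sym (^-distribʳ-* 2 2 n)) ⟩
  4 ^ n * n ^ h                      ∎
  where
  open ℕ.≤-Reasoning
  h = ⌊ n /2⌋

-- The last summand alone gives the right order of growth.
minimalSpeed-≥ : ∀ n → ⌊ n /2⌋ ! ≤ minimalSpeed n
minimalSpeed-≥ n = begin
  h !                          ≡⟨ sym (ℕ.*-identityˡ (h !)) ⟩
  1 * h !                      ≤⟨ ℕ.*-monoˡ-≤ (h !) (nCk>0 2h≤n) ⟩
  (n C (2 * h)) * h !          ≡⟨ cong (λ k → (n C (2 * k)) * k !) (sym (Fin.toℕ-fromℕ< (ℕ.n<1+n h))) ⟩
  term (fromℕ< (ℕ.n<1+n h))    ≤⟨ term≤sum term (fromℕ< (ℕ.n<1+n h)) ⟩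
  sum term                     ≡⟨ sym (minimalSpeed-∑ n) ⟩
  minimalSpeed n               ∎
  where
  open ℕ.≤-Reasoning
  h = ⌊ n /2⌋
  term : Fin (suc h) → ℕ
  term k = (n C (2 * toℕ k)) * toℕ k !
  2h≤n : 2 * h ≤ n
  2h≤n = ℕ.≤-trans (ℕ.+-monoʳ-≤ h (ℕ.≤-trans (ℕ.≤-reflexive (ℕ.+-identityʳ h)) (ℕ.⌊n/2⌋≤⌈n/2⌉ n)))
                   (ℕ.≤-reflexive (ℕ.⌊n/2⌋+⌈n/2⌉≡n n))

^-comm : ∀ a m n → (a ^ m) ^ n ≡ (a ^ n) ^ m
^-comm a m n = trans (ℕ.^-*-assoc a m n) (trans (cong (a ^_) (ℕ.*-comm m n)) (sym (ℕ.^-*-assoc a n m)))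

minimalSpeed-isHalfPower : IsHalfPower minimalSpeed
-- The lower bound loses `n ^ q` and `(144 ^ q) ^ n`, the upper one `(16 ^ q) ^ n`. Once `144 ^ q` ≤
-- `n`, each loss is at most `n ^ n`, and two factors `n ^ n` fit into `n ^ (2 * p * n)` since `p` ≥
-- 1.
minimalSpeed-isHalfPower p@(suc _) q@(suc q′) _ _ = 144 ^ q , λ n n₀≤n → lower n n₀≤n , upper n n₀≤n
  where
  open ℕ.≤-Reasoning
  module _ (n : ℕ) (n₀≤n : 144 ^ q ≤ n) where
    f = minimalSpeed n
    h = ⌊ n /2⌋
    144≤n : 144 ≤ n
    144≤n = ℕ.≤-trans (ℕ.≤-trans (ℕ.≤-reflexive (sym (ℕ.*-identityʳ 144))) (ℕ.*-monoʳ-≤ 144 (ℕ.m^n>0 144 q′))) n₀≤n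
    instance
      n≢0 : NonZero n
      n≢0 = ℕ.>-nonZero (ℕ.≤-trans (s≤s z≤n) 144≤n)
    h+h≤n : h + h ≤ n
    h+h≤n = ℕ.≤-trans (ℕ.+-monoʳ-≤ h (ℕ.⌊n/2⌋≤⌈n/2⌉ n)) (ℕ.≤-reflexive (ℕ.⌊n/2⌋+⌈n/2⌉≡n n))
    n≤1+h+h : n ≤ 1 + (h + h)
    n≤1+h+h = ≤1+2⌊/2⌋ n
      where
      ≤1+2⌊/2⌋ : ∀ n → n ≤ 1 + (⌊ n /2⌋ + ⌊ n /2⌋)
      ≤1+2⌊/2⌋ zero          = z≤n
      ≤1+2⌊/2⌋ (suc zero)    = ℕ.≤-refl
      ≤1+2⌊/2⌋ (suc (suc n)) = s≤s (ℕ.≤-trans (s≤s (≤1+2⌊/2⌋ n))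
        (ℕ.≤-reflexive (cong suc (sym (ℕ.+-suc ⌊ n /2⌋ ⌊ n /2⌋)))))
    n≤3*h : n ≤ 3 * h
    n≤3*h = ℕ.≤-trans n≤1+h+h (ℕ.≤-trans (ℕ.+-monoˡ-≤ (h + h) 1≤h) (ℕ.≤-reflexive (arith h)))
      where
      1≤h : 1 ≤ h
      1≤h = ℕ.⌊n/2⌋-mono (ℕ.≤-trans (s≤s (s≤s z≤n)) 144≤n)
      arith : ∀ h → h + (h + h) ≡ 3 * h
      arith = solve-∀
    n≤2pn : n + n ≤ 2 * p * n
    n≤2pn = ℕ.≤-trans (ℕ.≤-reflexive (cong (n +_) (sym (ℕ.+-identityʳ n))))
      (ℕ.*-monoˡ-≤ n {2} {2 * p} (ℕ.*-monoʳ-≤ 2 (s≤s z≤n)))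

    -- The factor `n` in front accounts for odd `n`. Each `n ^ h` costs `12 ^ n`: 3 from `n` ≤
    -- `3 * h`, and 4 from comparing `h ^ h` with `h !`; squaring gives 144.
    n^n≤ : n ^ n ≤ n * (144 ^ n * f ^ 2)
    n^n≤ = begin
      n ^ n                        ≤⟨ ℕ.^-monoʳ-≤ n n≤1+h+h ⟩
      n * n ^ (h + h)              ≡⟨ cong (n *_) (ℕ.^-distribˡ-+-* n h h) ⟩
      n * (n ^ h * n ^ h)          ≤⟨ ℕ.*-monoʳ-≤ n (ℕ.*-mono-≤ n^h≤ n^h≤) ⟩
      n * (12 ^ n * f * (12 ^ n * f)) ≡⟨ cong (n *_) (arith (12 ^ n) f) ⟩
      n * (12 ^ n * 12 ^ n * f ^ 2)   ≡⟨ cong (λ x → n * (x * f ^ 2)) (sym (^-distribʳ-* 12 12 n)) ⟩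
      n * (144 ^ n * f ^ 2)        ∎
      where
      arith : ∀ a b → a * b * (a * b) ≡ a * a * (b * (b * 1))
      arith = solve-∀
      n^h≤ : n ^ h ≤ 12 ^ n * f
      n^h≤ = begin
        n ^ h                ≤⟨ ℕ.^-monoˡ-≤ h n≤3*h ⟩
        (3 * h) ^ h          ≡⟨ ^-distribʳ-* 3 h h ⟩
        3 ^ h * h ^ h        ≤⟨ ℕ.*-monoʳ-≤ (3 ^ h) (n^n≤4^n*n! h) ⟩
        3 ^ h * (4 ^ h * h !) ≡⟨ sym (ℕ.*-assoc (3 ^ h) (4 ^ h) (h !)) ⟩
        3 ^ h * 4 ^ h * h !  ≡⟨ cong (_* h !) (sym (^-distribʳ-* 3 4 h)) ⟩
        12 ^ h * h !         ≤⟨ ℕ.*-mono-≤ (ℕ.^-monoʳ-≤ 12 (ℕ.⌊n/2⌋≤n n)) (minimalSpeed-≥ n) ⟩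
        12 ^ n * f           ∎

    lower : n ^ (q * n) ≤ f ^ (2 * q) * n ^ (2 * p * n)
    lower = begin
      n ^ (q * n)                       ≡⟨ cong (n ^_) (ℕ.*-comm q n) ⟩
      n ^ (n * q)                       ≡⟨ sym (ℕ.^-*-assoc n n q) ⟩
      (n ^ n) ^ q                       ≤⟨ ℕ.^-monoˡ-≤ q n^n≤ ⟩
      (n * (144 ^ n * f ^ 2)) ^ q       ≡⟨ trans (^-distribʳ-* n (144 ^ n * f ^ 2) q) (cong (n ^ q *_) (^-distribʳ-* (144 ^ n) (f ^ 2) q)) ⟩
      n ^ q * ((144 ^ n) ^ q * (f ^ 2) ^ q) ≡⟨ cong₂ (λ x y → n ^ q * (x * y)) (^-comm 144 n q) (ℕ.^-*-assoc f 2 q) ⟩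
      n ^ q * ((144 ^ q) ^ n * f ^ (2 * q))
        ≤⟨ ℕ.*-mono-≤ (ℕ.^-monoʳ-≤ n q≤n) (ℕ.*-monoˡ-≤ (f ^ (2 * q)) (ℕ.^-monoˡ-≤ n n₀≤n)) ⟩
      n ^ n * (n ^ n * f ^ (2 * q))     ≡⟨ arith (n ^ n) (f ^ (2 * q)) ⟩
      f ^ (2 * q) * (n ^ n * n ^ n)     ≡⟨ cong (f ^ (2 * q) *_) (sym (ℕ.^-distribˡ-+-* n n n)) ⟩
      f ^ (2 * q) * n ^ (n + n)         ≤⟨ ℕ.*-monoʳ-≤ (f ^ (2 * q)) (ℕ.^-monoʳ-≤ n n≤2pn) ⟩
      f ^ (2 * q) * n ^ (2 * p * n)     ∎
      where
      arith : ∀ a b → a * (a * b) ≡ b * (a * a)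
      arith = solve-∀
      q≤n : q ≤ n
      q≤n = ℕ.≤-trans (ℕ.<⇒≤ (n<2^n q)) (ℕ.≤-trans (ℕ.^-monoˡ-≤ q (s≤s (s≤s z≤n))) n₀≤n)

    upper : f ^ (2 * q) ≤ n ^ (q * n + 2 * p * n)
    upper = begin
      f ^ (2 * q)                       ≤⟨ ℕ.^-monoˡ-≤ (2 * q) (minimalSpeed-≤ n) ⟩
      (4 ^ n * n ^ h) ^ (2 * q)         ≡⟨ ^-distribʳ-* (4 ^ n) (n ^ h) (2 * q) ⟩
      (4 ^ n) ^ (2 * q) * (n ^ h) ^ (2 * q)
        ≡⟨ cong₂ _*_ (trans (^-comm 4 n (2 * q)) (cong (_^ n) (sym (ℕ.^-*-assoc 4 2 q))))
                     (trans (ℕ.^-*-assoc n h (2 * q)) (cong (n ^_) (arith h q))) ⟩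
      (16 ^ q) ^ n * n ^ (q * (h + h))  ≤⟨ ℕ.*-mono-≤ (ℕ.^-monoˡ-≤ n (ℕ.≤-trans (ℕ.^-monoˡ-≤ q 16≤144) n₀≤n))
                                                       (ℕ.^-monoʳ-≤ n (ℕ.*-monoʳ-≤ q h+h≤n)) ⟩
      n ^ n * n ^ (q * n)               ≤⟨ ℕ.*-monoˡ-≤ (n ^ (q * n)) (ℕ.^-monoʳ-≤ n (ℕ.≤-trans (ℕ.m≤m+n n n) n≤2pn)) ⟩
      n ^ (2 * p * n) * n ^ (q * n)     ≡⟨ ℕ.*-comm (n ^ (2 * p * n)) (n ^ (q * n)) ⟩
      n ^ (q * n) * n ^ (2 * p * n)     ≡⟨ sym (ℕ.^-distribˡ-+-* n (q * n) (2 * p * n)) ⟩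
      n ^ (q * n + 2 * p * n)           ∎
      where
      arith : ∀ h q → h * (2 * q) ≡ q * (h + h)
      arith = solve-∀
      16≤144 : 16 ≤ 144
      16≤144 = ℕ.m≤m+n 16 128

minimalSpeed-superexponential : ∀ a → ∃[ n ] a ^ n < minimalSpeed n
minimalSpeed-superexponential a = n , ℕ.<-≤-trans (ℕ.^-monoˡ-< n (ℕ.n<1+n a)) b^n≤f
  where
  -- With ε = 1/4 the lower bound becomes `n ^ (2 * n)` ≤ `f ^ 8`. As `n` ≥ `b ^ 4`, its left side
  -- is at least `(b ^ n) ^ 8`. Strictness comes from `a` < `b` and `n` > 0.
  b = suc a
  n₀ = proj₁ (minimalSpeed-isHalfPower 1 4 (s≤s z≤n) (s≤s z≤n))
  n = b ^ 4 + n₀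
  f = minimalSpeed n
  instance
    n≢0 : NonZero n
    n≢0 = ℕ.>-nonZero (ℕ.≤-trans (ℕ.m^n>0 b 4) (ℕ.m≤m+n (b ^ 4) n₀))
  open ℕ.≤-Reasoning
  half : n ^ (4 * n) ≤ f ^ 8 * n ^ (2 * n)
  half = proj₁ (proj₂ (minimalSpeed-isHalfPower 1 4 (s≤s z≤n) (s≤s z≤n)) n (ℕ.m≤n+m n₀ (b ^ 4)))
  n^2n≤f^8 : n ^ (2 * n) ≤ f ^ 8
  n^2n≤f^8 = ℕ.*-cancelʳ-≤ _ _ (n ^ (2 * n)) {{ℕ.m^n≢0 n (2 * n)}}
    (ℕ.≤-trans (ℕ.≤-reflexive (trans (sym (ℕ.^-distribˡ-+-* n (2 * n) (2 * n))) (cong (n ^_) (arith n)))) half)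
    where
    arith : ∀ n → 2 * n + 2 * n ≡ 4 * n
    arith = solve-∀
  b^n^8≤f^8 : (b ^ n) ^ 8 ≤ f ^ 8
  b^n^8≤f^8 = begin
    (b ^ n) ^ 8        ≡⟨ ^-comm b n 8 ⟩
    (b ^ 8) ^ n        ≡⟨ cong (_^ n) (sym (ℕ.^-*-assoc b 4 2)) ⟩
    ((b ^ 4) ^ 2) ^ n  ≡⟨ ℕ.^-*-assoc (b ^ 4) 2 n ⟩
    (b ^ 4) ^ (2 * n)  ≤⟨ ℕ.^-monoˡ-≤ (2 * n) (ℕ.m≤m+n (b ^ 4) n₀) ⟩
    n ^ (2 * n)        ≤⟨ n^2n≤f^8 ⟩
    f ^ 8              ∎
  b^n≤f : b ^ n ≤ f
  b^n≤f = ℕ.≮⇒≥ λ f<b^n → ℕ.<⇒≱ (ℕ.^-monoˡ-< 8 f<b^n) b^n^8≤f^8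

-- Enumeration of subsets and permutations

-- Subsets of size k of an n-element chain, built along Pascal's rule so that counting them follows
-- the recursion of the binomial coefficients.
data Comb : ℕ → ℕ → Set where
  []   : Comb 0 0
  skip : ∀ {n k} → Comb n k → Comb (suc n) k
  take : ∀ {n k} → Comb n k → Comb (suc n) (suc k)

pick : ∀ {n k} → Comb n k → Fin k → Fin n
pick (skip c) i       = suc (pick c i)
pick (take c) zero    = zero
pick (take c) (suc i) = suc (pick c i)

pick-increasing : ∀ {n k} (c : Comb n k) → Increasing (pick c)
pick-increasing (skip c)                   i<j = s≤s (pick-increasing c i<j)
pick-increasing (take c) {zero}  {suc j} i<j = s≤s z≤n
pick-increasing (take c) {suc i} {suc j} i<j = s≤s (pick-increasing c (s≤s⁻¹ i<j))

lowerAll : ∀ {n k} (e : Fin k → Fin (suc n)) → Increasing e → (∀ i → zero {n} Fin.< e i) →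
           ∃[ e′ ] Increasing {k} {n} e′ × ∀ i → suc (e′ i) ≡ e i
lowerAll e e< pos = (λ i → punchOut (Fin.<⇒≢ (pos i)))
  , (λ {i} {j} i<j → s≤s⁻¹ (subst₂ Fin._<_ (sym (eq i)) (sym (eq j)) (e< i<j))) , eq
  where
  eq : ∀ i → suc (punchOut (Fin.<⇒≢ (pos i))) ≡ e i
  eq i = Fin.punchIn-punchOut (Fin.<⇒≢ (pos i))

increasing⇒pick : ∀ {n k} (e : Fin k → Fin n) → Increasing e → ∃[ c ] pick {n} {k} c ≗ e
increasing⇒pick {zero}  {zero}  e e< = [] , λ ()
increasing⇒pick {zero}  {suc k} e e< with () ← e zero
increasing⇒pick {suc n} {zero}  e e< = skip (proj₁ (increasing⇒pick {n} (λ ()) λ { {()} })) , λ ()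
increasing⇒pick {suc n} {suc k} e e< with e zero in eq₀
... | zero  =
  let e′ , e′< , eq = lowerAll (e ∘ suc) (e< ∘ s≤s) (λ i → subst (Fin._< e (suc i)) eq₀ (e< (s≤s z≤n)))
      c , c≗ = increasing⇒pick e′ e′<
  in take c , λ { zero → sym eq₀ ; (suc i) → trans (cong suc (c≗ i)) (eq i) }
... | suc x =
  let e′ , e′< , eq = lowerAll e e< λ { zero → subst (zero {n} Fin.<_) (sym eq₀) (s≤s z≤n)
                                      ; (suc i) → ℕ.≤-<-trans z≤n (e< {zero} {suc i} (s≤s z≤n)) }
      c , c≗ = increasing⇒pick e′ e′<
  in skip c , λ i → trans (cong suc (c≗ i)) (eq i)

-- The sizes are recovered too: the endpoints of a graph must determine the number of its arcs.
pick-image-injective : ∀ {n j k} (c : Comb n j) (d : Comb n k) →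
  (∀ x → ∃[ y ] pick d y ≡ pick c x) → (∀ y → ∃[ x ] pick c x ≡ pick d y) →
  _≡_ {A = Σ ℕ (Comb n)} (j , c) (k , d)
pick-image-injective []       []       c⊆d d⊆c = refl
pick-image-injective (skip c) (skip d) c⊆d d⊆c = cong (λ { (j , c) → j , skip c }) (pick-image-injective c d
  (λ x → let y , e = c⊆d x in y , Fin.suc-injective e)
  (λ y → let x , e = d⊆c y in x , Fin.suc-injective e))
pick-image-injective (take c) (take d) c⊆d d⊆c = cong (λ { (j , c) → suc j , take c }) (pick-image-injective c d
  (λ x → strip d (c⊆d (suc x))) (λ y → strip c (d⊆c (suc y))))
  where
  strip : ∀ {n k} (c : Comb n k) {z} → ∃[ y ] pick (take c) y ≡ suc z → ∃[ y ] pick c y ≡ z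
  strip c (suc y , e) = y , Fin.suc-injective e
pick-image-injective (take c) (skip d) c⊆d d⊆c with () ← proj₂ (c⊆d zero)
pick-image-injective (skip c) (take d) c⊆d d⊆c with () ← proj₂ (d⊆c zero)

Comb↔ : ∀ n k → Comb n k ↔ Fin (n C k)
Comb↔ zero zero = mk↔ₛ′ (λ _ → zero) (λ _ → []) (λ { zero → refl }) (λ { [] → refl })
Comb↔ zero (suc k) = mk↔ₛ′ (λ ()) (λ ()) (λ ()) (λ ())
Comb↔ (suc n) zero = Comb↔ n zero ↔-∘ mk↔ₛ′ (λ { (skip c) → c }) skip (λ _ → refl) (λ { (skip c) → refl })
Comb↔ (suc n) (suc k) = subst (λ a → Comb (suc n) (suc k) ↔ Fin a) (nCk+nC[k+1]≡[n+1]C[k+1] n k) (↔-sym Fin.+↔⊎ ↔-∘ both)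
  where
  module T = Inverse (Comb↔ n k)
  module S = Inverse (Comb↔ n (suc k))
  both : Comb (suc n) (suc k) ↔ (Fin (n C k) ⊎ Fin (n C suc k))
  both = mk↔ₛ′ (λ { (take c) → inj₁ (T.to c) ; (skip c) → inj₂ (S.to c) })
    (λ { (inj₁ x) → take (T.from x) ; (inj₂ x) → skip (S.from x) })
    (λ { (inj₁ x) → cong inj₁ (T.strictlyInverseˡ x) ; (inj₂ x) → cong inj₂ (S.strictlyInverseˡ x) })
    (λ { (take c) → cong take (T.strictlyInverseʳ c) ; (skip c) → cong skip (S.strictlyInverseʳ c) })

-- The Lehmer code: the leading digit is the image of `zero`, the remaining digits describe the
-- permutation left after deleting that point and its image.
perm : ∀ k → Fin (k !) → Permutation′ k
perm zero    x = Perm.id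
perm (suc k) x = extend (remQuot {suc k} (k !) x)
  where
  extend : Fin (suc k) × Fin (k !) → Permutation′ (suc k)
  extend (i , y) = insert zero i (perm k y)

perm-injective : ∀ k {x y} → (∀ i → perm k x ⟨$⟩ʳ i ≡ perm k y ⟨$⟩ʳ i) → x ≡ y
perm-injective zero    {zero} {zero} eq = refl
perm-injective (suc k) {x} {y} eq =
  trans (sym (Fin.combine-remQuot {suc k} (k !) x))
        (trans (cong (uncurry combine) (extend-injective (remQuot {suc k} (k !) x) (remQuot {suc k} (k !) y) eq))
               (Fin.combine-remQuot {suc k} (k !) y))
  where
  extend-injective : (p q : Fin (suc k) × Fin (k !)) →
    (∀ j → insert zero (proj₁ p) (perm k (proj₂ p)) ⟨$⟩ʳ j ≡ insert zero (proj₁ q) (perm k (proj₂ q)) ⟨$⟩ʳ j) → p ≡ q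
  extend-injective (i , x) (j , y) eq
    with trans (sym (insert-self zero i (perm k x))) (trans (eq zero) (insert-self zero j (perm k y)))
  ... | refl = cong (i ,_) (perm-injective k λ l → Fin.punchIn-injective i _ _
    (trans (sym (insert-punchIn zero i (perm k x) l)) (trans (eq (suc l)) (insert-punchIn zero i (perm k y) l))))

perm-surjective : ∀ k (π : Permutation′ k) → ∃[ x ] ∀ i → perm k x ⟨$⟩ʳ i ≡ π ⟨$⟩ʳ i
perm-surjective zero    π = zero , λ ()
perm-surjective (suc k) π =
  let y , y≈ = perm-surjective k (remove zero π)
      i₀ = π ⟨$⟩ʳ zero
      insert≈ : ∀ j → insert zero i₀ (perm k y) ⟨$⟩ʳ j ≡ π ⟨$⟩ʳ j
      insert≈ = λ { zero → insert-self zero i₀ (perm k y)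
                  ; (suc j) → trans (insert-punchIn zero i₀ (perm k y) j)
                                    (trans (cong (punchIn i₀) (y≈ j)) (sym (punchIn-permute π zero j))) }
  in combine i₀ y , λ j →
    trans (cong (λ z → insert zero (proj₁ z) (perm k (proj₂ z)) ⟨$⟩ʳ j) (Fin.remQuot-combine {suc k} i₀ y)) (insert≈ j)

Σ-Fin↔ : ∀ {m} (a : Fin m → ℕ) → Σ (Fin m) (Fin ∘ a) ↔ Fin (sum a)
Σ-Fin↔ {zero}  a = mk↔ₛ′ (λ { (() , _) }) (λ ()) (λ ()) (λ { (() , _) })
Σ-Fin↔ {suc m} a = ↔-sym Fin.+↔⊎ ↔-∘ mk↔ₛ′
  (λ { (zero , x) → inj₁ x ; (suc i , x) → inj₂ (I.to (i , x)) })
  (λ { (inj₁ x) → zero , x ; (inj₂ y) → suc (proj₁ (I.from y)) , proj₂ (I.from y) })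
  (λ { (inj₁ x) → refl ; (inj₂ y) → cong inj₂ (I.strictlyInverseˡ y) })
  (λ { (zero , x) → refl ; (suc i , x) → cong (λ { (i , x) → suc i , x }) (I.strictlyInverseʳ (i , x)) })
  where
  module I = Inverse (Σ-Fin↔ (a ∘ suc))

-- Matchings

-- Degree at most 1, split by the directions of two arcs meeting at a vertex.
record IsMatching {n} (A : Arcs n) : Set where
  open Arcs A using (_⟶_; _⟶?_)
  field
    out-unique : ∀ {u v w} → u ⟶ v → u ⟶ w → v ≡ w
    in-unique  : ∀ {u v w} → v ⟶ u → w ⟶ u → v ≡ w
    no-path    : ∀ {u v w} → u ⟶ v → ¬ (v ⟶ w)

  neighbour-unique : ∀ {u v w} → u ⟶ v ⊎ v ⟶ u → u ⟶ w ⊎ w ⟶ u → v ≡ w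
  neighbour-unique (inj₁ a) (inj₁ b) = out-unique a b
  neighbour-unique (inj₁ a) (inj₂ b) = contradiction a (no-path b)
  neighbour-unique (inj₂ a) (inj₁ b) = contradiction b (no-path a)
  neighbour-unique (inj₂ a) (inj₂ b) = in-unique a b

  maxDegree≤1 : maxDegree (graph A) ≤ 1
  maxDegree≤1 = max≤v⁺ z≤n (All.map⁺ (All.map⁺ (All.universal degree≤1 (allFin n))))
    where
    module G = OrderedGraph (graph A)
    atMostOne : ∀ {P : Fin n → Set} {xs} → Unique xs → All P xs → (∀ {v w} → P v → P w → v ≡ w) → length xs ≤ 1
    atMostOne []                     _              _      = z≤n
    atMostOne (_ ∷ [])               _              _      = ℕ.≤-refl
    atMostOne ((v≢w ∷ _) ∷ (_ ∷ _)) (p ∷ q ∷ _)    unique = contradiction (unique p q) v≢w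
    degree≤1 : ∀ u → G.degree u ≤ 1
    degree≤1 u = atMostOne (Unique.filter⁺ (G.Adj? u) (Unique.map⁺ id (Unique.allFin⁺ n)))
                           (All.all-filter (G.Adj? u) G.vertices) neighbour-unique

  -- An isolated vertex is its own partner, which makes the partner map a total involution and hence
  -- a permutation.
  data Partner (u : Fin n) : Fin n → Set where
    out      : ∀ {v} → u ⟶ v → Partner u v
    into     : ∀ {v} → v ⟶ u → Partner u v
    isolated : (∀ v → ¬ (u ⟶ v)) → (∀ v → ¬ (v ⟶ u)) → Partner u u

  Partner-unique : ∀ {u v w} → Partner u v → Partner u w → v ≡ w
  Partner-unique (out a)        (out b)        = out-unique a b
  Partner-unique (out a)        (into b)       = contradiction a (no-path b)
  Partner-unique (out a)        (isolated o _) = contradiction a (o _)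
  Partner-unique (into a)       (out b)        = contradiction b (no-path a)
  Partner-unique (into a)       (into b)       = in-unique a b
  Partner-unique (into a)       (isolated _ i) = contradiction a (i _)
  Partner-unique (isolated o _) (out b)        = contradiction b (o _)
  Partner-unique (isolated _ i) (into b)       = contradiction b (i _)
  Partner-unique (isolated _ _) (isolated _ _) = refl

  Partner-sym : ∀ {u v} → Partner u v → Partner v u
  Partner-sym (out a)        = into a
  Partner-sym (into a)       = out a
  Partner-sym (isolated o i) = isolated o i

  partner : ∀ u → ∃[ v ] Partner u v
  partner u with Fin.any? (u ⟶?_) | Fin.any? (_⟶? u)
  ... | yes (v , a) | _           = v , out a
  ... | no _        | yes (v , a) = v , into a
  ... | no ¬o       | no ¬i       = u , isolated (λ v a → ¬o (v , a)) (λ v a → ¬i (v , a))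

  partnerPermutation : Permutation′ n
  partnerPermutation = permutation p p p∘p p∘p
    where
    p = proj₁ ∘ partner
    p∘p : ∀ u → p (p u) ≡ u
    p∘p u = Partner-unique (proj₂ (partner (p u))) (Partner-sym (proj₂ (partner u)))

-- Listing both sides in increasing order leaves no freedom of labelling, so `π` is determined by
-- the graph.
record Config (n k : ℕ) : Set where
  field
    l r    : Fin k → Fin n
    l-incr : Increasing l
    r-incr : Increasing r
    l<r    : ∀ i j → l i Fin.< r j
    π      : Permutation′ k

  configArcs : Arcs n
  configArcs = record
    { _⟶_  = λ u v → ∃[ i ] (u ≡ l i × v ≡ r (π ⟨$⟩ʳ i))
    ; _⟶?_ = λ u v → Fin.any? λ i → (u Fin.≟ l i) ×-dec (v Fin.≟ r (π ⟨$⟩ʳ i))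
    ; ⟶⇒<  = λ { (i , refl , refl) → l<r i (π ⟨$⟩ʳ i) } }

  open Arcs configArcs using (_⟶_)

  l-injective = increasing⇒injective l-incr
  r-injective = increasing⇒injective r-incr

  isMatching : IsMatching configArcs
  isMatching = record
    { out-unique = λ { (i , p , refl) (j , q , refl) → cong (r ∘ (π ⟨$⟩ʳ_)) (l-injective (trans (sym p) q)) }
    ; in-unique  = λ { (i , refl , p) (j , refl , q) →
        cong l (trans (sym (inverseˡ π)) (trans (cong (π ⟨$⟩ˡ_) (r-injective (trans (sym p) q))) (inverseˡ π))) }
    ; no-path    = λ { (i , _ , p) (j , q , _) → Fin.<⇒≢ (l<r j (π ⟨$⟩ʳ i)) (trans (sym q) p) }
    }

  open IsMatching isMatching public using (maxDegree≤1)
  open IsMatching isMatching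

  -- Vertex u goes to u or n + u, according to its side of a cut between the
  -- left and the right endpoints, so an arc u → v goes to {u, n + partner(u)}.
  configGraph⊑H : graph configArcs ⊑ H partnerPermutation
  configGraph⊑H = record
    { to           = embed
    ; to-injective = increasing⇒injective embed-incr
    ; ≺-⇔          = increasing-⇔ embed-incr
    ; Adj-⇒        = λ { (inj₁ a) → inj₁ (embed-arc a) ; (inj₂ a) → inj₂ (embed-arc a) } }
    where
    -- The cut comes right after the last left endpoint; without arcs every vertex goes to the
    -- right.
    left? : ∀ u → Dec (∃[ i ] u Fin.≤ l i)
    left? u = Fin.any? λ i → u Fin.≤? l i
    embed : Fin n → Fin (n + n)
    embed u with left? u
    ... | yes _ = u ↑ˡ n
    ... | no  _ = n ↑ʳ u
    embed-incr : Increasing embed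
    embed-incr {u} {v} u<v with left? u | left? v
    ... | yes _ | yes _ = subst₂ _<_ (sym (Fin.toℕ-↑ˡ u n)) (sym (Fin.toℕ-↑ˡ v n)) u<v
    ... | yes _ | no  _ = subst₂ _<_ (sym (Fin.toℕ-↑ˡ u n)) (sym (Fin.toℕ-↑ʳ n v))
                            (ℕ.<-≤-trans (Fin.toℕ<n u) (ℕ.m≤m+n n (toℕ v)))
    ... | no  _ | no  _ = subst₂ _<_ (sym (Fin.toℕ-↑ʳ n u)) (sym (Fin.toℕ-↑ʳ n v)) (ℕ.+-monoʳ-< n u<v)
    ... | no ¬u | yes (i , v≤l) = contradiction (i , ℕ.≤-trans (ℕ.<⇒≤ u<v) v≤l) ¬u
    embed-arc : ∀ {u v} → u ⟶ v → Arc partnerPermutation (embed u) (embed v)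
    embed-arc {u} {v} a@(i , p , q) with left? u | left? v
    ... | yes _ | no _ = u , refl , cong (n ↑ʳ_) (Partner-unique (out a) (proj₂ (partner u)))
    ... | no ¬u | _    = contradiction (i , ℕ.≤-reflexive (cong toℕ p)) ¬u
    ... | yes _ | yes (j , v≤l) =
      contradiction (ℕ.<-≤-trans (l<r j (π ⟨$⟩ʳ i)) (subst (λ v → v Fin.≤ l j) q v≤l)) (ℕ.<-irrefl refl)

open Config using (configArcs; configGraph⊑H)

used? : ∀ {n M k} (A : Arcs n) (f : Fin n → Fin M) (π : Permutation′ k) (L R : Fin k → Fin M) →
        ∀ i → Dec (∃[ u ] ∃[ v ] f u ≡ L i × f v ≡ R (π ⟨$⟩ʳ i) × Arcs._⟶_ A u v)
used? A f π L R i = Fin.any? λ u → Fin.any? λ v →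
  (f u Fin.≟ L i) ×-dec (f v Fin.≟ R (π ⟨$⟩ʳ i)) ×-dec Arcs._⟶?_ A u v

-- The recursion removes an index i of π whose arc L(i) → R(π(i)) is absent from A.
toConfig : ∀ {n M k} (A : Arcs n) (f : Fin n → Fin M) → Increasing f →
  (π : Permutation′ k) (L R : Fin k → Fin M) → Increasing L → Increasing R → (∀ i j → L i Fin.< R j) →
  (∀ {u v} → Arcs._⟶_ A u v → ∃[ i ] (f u ≡ L i × f v ≡ R (π ⟨$⟩ʳ i))) →
  ∃₂ λ k′ (c : Config n k′) → ∀ u v → Arcs._⟶_ (configArcs c) u v ⇔ Arcs._⟶_ A u v
toConfig {n} {M} {k} A f f< π L R L< R< L<R arc⇒ with Fin.all? (used? A f π L R)
... | yes used = k , c , λ u v → mk⇔ (λ { (i , refl , refl) → arc i }) from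
  where
  open Arcs A using (_⟶_; _⟶?_)
  l r r′ : Fin k → Fin n
  l i = proj₁ (used i)
  r′ i = proj₁ (proj₂ (used i))
  r j = r′ (π ⟨$⟩ˡ j)
  fl≡ : ∀ i → f (l i) ≡ L i
  fl≡ i = proj₁ (proj₂ (proj₂ (used i)))
  fr≡ : ∀ j → f (r j) ≡ R j
  fr≡ j = trans (proj₁ (proj₂ (proj₂ (proj₂ (used (π ⟨$⟩ˡ j)))))) (cong R (inverseʳ π))
  c : Config n k
  c = record
    { l = l ; r = r ; π = π
    ; l-incr = λ {i} {j} i<j → increasing-cancel f< (subst₂ Fin._<_ (sym (fl≡ i)) (sym (fl≡ j)) (L< i<j))
    ; r-incr = λ {i} {j} i<j → increasing-cancel f< (subst₂ Fin._<_ (sym (fr≡ i)) (sym (fr≡ j)) (R< i<j))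
    ; l<r    = λ i j → increasing-cancel f< (subst₂ Fin._<_ (sym (fl≡ i)) (sym (fr≡ j)) (L<R i j)) }
  arc : ∀ i → l i ⟶ r (π ⟨$⟩ʳ i)
  arc i = subst (λ x → l i ⟶ r′ x) (sym (inverseˡ π {i})) (proj₂ (proj₂ (proj₂ (proj₂ (used i)))))
  from : ∀ {u v} → u ⟶ v → ∃[ i ] (u ≡ l i × v ≡ r (π ⟨$⟩ʳ i))
  from a = let i , p , q = arc⇒ a in
    i , increasing⇒injective f< (trans p (sym (fl≡ i))) , increasing⇒injective f< (trans q (sym (fr≡ (π ⟨$⟩ʳ i))))
toConfig {k = zero}  A f f< π L R L< R< L<R arc⇒ | no ¬used = contradiction (λ ()) ¬used
toConfig {k = suc k} A f f< π L R L< R< L<R arc⇒ | no ¬used =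
  toConfig A f f< (remove i π) (L ∘ punchIn i) (R ∘ punchIn (π ⟨$⟩ʳ i))
    (L< ∘ punchIn-increasing i) (R< ∘ punchIn-increasing (π ⟨$⟩ʳ i)) (λ _ _ → L<R _ _) arc⇒′
  where
  open Arcs A using (_⟶_; _⟶?_)
  unused = Fin.¬∀⟶∃¬ (suc k) _ (used? A f π L R) ¬used
  i = proj₁ unused
  arc⇒′ : ∀ {u v} → u ⟶ v → ∃[ j ] (f u ≡ L (punchIn i j) × f v ≡ R (punchIn (π ⟨$⟩ʳ i) (remove i π ⟨$⟩ʳ j)))
  arc⇒′ {u} {v} a with arc⇒ a
  ... | j , p , q with i Fin.≟ j
  ...   | yes refl = contradiction (u , v , p , q , a) (proj₂ unused)
  ...   | no i≢j = punchOut i≢j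
    , trans p (cong L (sym (Fin.punchIn-punchOut i≢j)))
    , trans q (cong R (trans (cong (π ⟨$⟩ʳ_) (sym (Fin.punchIn-punchOut i≢j))) (punchIn-permute π i (punchOut i≢j))))

↑ˡ-increasing : ∀ {m} n → Increasing {m} (_↑ˡ n)
↑ˡ-increasing n {i} {j} i<j = subst₂ _<_ (sym (Fin.toℕ-↑ˡ i n)) (sym (Fin.toℕ-↑ˡ j n)) i<j

↑ʳ-increasing : ∀ m {n} → Increasing {n} (m ↑ʳ_)
↑ʳ-increasing m {n} {i} {j} i<j = subst₂ _<_ (sym (Fin.toℕ-↑ʳ m i)) (sym (Fin.toℕ-↑ʳ m j)) (ℕ.+-monoʳ-< m i<j)

↑ˡ<↑ʳ : ∀ {m n} (i : Fin m) (j : Fin n) → i ↑ˡ n Fin.< m ↑ʳ j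
↑ˡ<↑ʳ {m} {n} i j = subst₂ _<_ (sym (Fin.toℕ-↑ˡ i n)) (sym (Fin.toℕ-↑ʳ m j))
  (ℕ.<-≤-trans (Fin.toℕ<n i) (ℕ.m≤m+n m (toℕ j)))

2*-split : ∀ k (x : Fin (2 * k)) → (∃[ i ] x ≡ i ↑ˡ (k + 0)) ⊎ (∃[ j ] x ≡ k ↑ʳ (j ↑ˡ 0))
2*-split k x with splitAt k x in p
... | inj₁ i = inj₁ (i , sym (Fin.splitAt⁻¹-↑ˡ p))
... | inj₂ y with splitAt k y in q
...   | inj₁ j = inj₂ (j , trans (sym (Fin.splitAt⁻¹-↑ʳ {m = k} p)) (cong (k ↑ʳ_) (sym (Fin.splitAt⁻¹-↑ˡ q))))

-- The smaller half of the picked vertices are left ends, the larger half right ends. As `2 * k`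
-- unfolds to `k + (k + 0)`, the indices carry the summands `k + 0` and `0`.
combConfig : ∀ {n} k → Comb n (2 * k) → Permutation′ k → Config n k
combConfig k c π = record
  { l      = λ i → pick c (i ↑ˡ (k + 0))
  ; r      = λ j → pick c (k ↑ʳ (j ↑ˡ 0))
  ; l-incr = pick-increasing c ∘ ↑ˡ-increasing (k + 0)
  ; r-incr = pick-increasing c ∘ ↑ʳ-increasing k ∘ ↑ˡ-increasing 0
  ; l<r    = λ i j → pick-increasing c (↑ˡ<↑ʳ i (j ↑ˡ 0))
  ; π      = π }

pick-⊆ : ∀ {n j k} (c : Comb n (2 * j)) (d : Comb n (2 * k)) (π : Permutation′ j) (ρ : Permutation′ k) →
         (∀ {u v} → Arcs._⟶_ (configArcs (combConfig j c π)) u v → Arcs._⟶_ (configArcs (combConfig k d ρ)) u v) →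
         ∀ x → ∃[ y ] pick d y ≡ pick c x
pick-⊆ {j = j} c d π ρ A⇒B x with 2*-split j x
... | inj₁ (i , refl) = let _ , p , _ = A⇒B (i , refl , refl) in _ , sym p
... | inj₂ (i , refl) =
  let _ , _ , q = A⇒B (π ⟨$⟩ˡ i , refl , cong (λ i → pick c (j ↑ʳ (i ↑ˡ 0))) (sym (inverseʳ π)))
  in _ , sym q

-- Every picked vertex is an end of some arc, so the arcs determine the picked set. This fixes the
-- number of arcs and the subset, and `π` is then read off arc by arc.
combConfig-determines : ∀ {n j k} (c : Comb n (2 * j)) (d : Comb n (2 * k)) (π : Permutation′ j) (ρ : Permutation′ k) →
  (∀ u v → Arcs._⟶_ (configArcs (combConfig j c π)) u v ⇔ Arcs._⟶_ (configArcs (combConfig k d ρ)) u v) →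
  Σ (j ≡ k) λ { refl → c ≡ d × ∀ i → π ⟨$⟩ʳ i ≡ ρ ⟨$⟩ʳ i }
combConfig-determines {n} {j} {k} c d π ρ e
  with pick-image-injective c d (pick-⊆ c d π ρ (Equivalence.to (e _ _))) (pick-⊆ d c ρ π (Equivalence.from (e _ _)))
... | same with ℕ.*-cancelˡ-≡ j k 2 (cong proj₁ same)
...   | refl with ,-injectiveʳ-UIP ℕ.≡-irrelevant same
...     | refl = refl , refl , λ i → let i′ , p , q = Equivalence.to (e _ _) (i , refl , refl) in
  trans (r-injective q) (cong (ρ ⟨$⟩ʳ_) (sym (l-injective p)))
  where open Config (combConfig j c ρ) using (l-injective; r-injective)

-- The permutation is left open up to pointwise equality, the sense in which `perm` reaches every
-- permutation.
combConfig-surjective : ∀ {n k} (C : Config n k) →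
  ∃[ c ] ∀ π → (∀ i → π ⟨$⟩ʳ i ≡ Config.π C ⟨$⟩ʳ i) →
    ∀ u v → Arcs._⟶_ (configArcs (combConfig k c π)) u v ⇔ Arcs._⟶_ (configArcs C) u v
combConfig-surjective {n} {k} C = c , λ π π≈ u v → mk⇔
  (λ { (i , p , q) → i , trans p (l≡ i) , trans q (trans (r≡ (π ⟨$⟩ʳ i)) (cong r (π≈ i))) })
  (λ { (i , p , q) → i , trans p (sym (l≡ i)) , trans q (trans (cong r (sym (π≈ i))) (sym (r≡ (π ⟨$⟩ʳ i)))) })
  where
  open Config C using (l; r; l-incr; r-incr; l<r)
  none : Fin 0 → Fin n
  none ()
  e : Fin (2 * k) → Fin n
  e = l ∥ (r ∥ none)
  r∥-increasing : Increasing (r ∥ none)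
  r∥-increasing = ∥-increasing r-incr (λ { {()} }) (λ _ ())
  l<r∥ : ∀ i j → l i Fin.< (r ∥ none) j
  l<r∥ i j with splitAt k j
  ... | inj₁ j′ = l<r i j′
  picked = increasing⇒pick e (∥-increasing l-incr r∥-increasing l<r∥)
  c = proj₁ picked
  l≡ : ∀ i → pick c (i ↑ˡ (k + 0)) ≡ l i
  l≡ i = trans (proj₂ picked _) (lookup-++ˡ l (r ∥ none) i)
  r≡ : ∀ j → pick c (k ↑ʳ (j ↑ˡ 0)) ≡ r j
  r≡ j = trans (proj₂ picked _) (trans (lookup-++ʳ l (r ∥ none) (j ↑ˡ 0)) (lookup-++ˡ r none j))

comb-bound : ∀ {n k} → Comb n k → k ≤ n
comb-bound c = Fin.injective⇒≤ (increasing⇒injective (pick-increasing c))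

-- Enumeration of the subgraphs of all H(π) on n vertices

module _ (n : ℕ) where

  private
    term : Fin (suc ⌊ n /2⌋) → ℕ
    term k = (n C (2 * toℕ k)) * toℕ k !

    Code : Set
    Code = Σ (Fin (suc ⌊ n /2⌋)) (Fin ∘ term)

    comb : ∀ k → Fin (n C k) → Comb n k
    comb k = Inverse.from (Comb↔ n k)

    configOf : ∀ k → Fin (n C (2 * k)) × Fin (k !) → Config n k
    configOf k (x , y) = combConfig k (comb (2 * k) x) (perm k y)

    member : Code → Arcs n
    member (k , z) = configArcs (configOf (toℕ k) (remQuot (toℕ k !) z))

    member-injective : ∀ {x y} → (∀ u v → Arcs._⟶_ (member x) u v ⇔ Arcs._⟶_ (member y) u v) → x ≡ y
    member-injective {k , z} {k′ , z′} e = go (remQuot (toℕ k !) z) (remQuot (toℕ k′ !) z′)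
        (Fin.combine-remQuot {n C (2 * toℕ k)} (toℕ k !) z) (Fin.combine-remQuot {n C (2 * toℕ k′)} (toℕ k′ !) z′) e
      where
      go : ∀ p q → uncurry combine p ≡ z → uncurry combine q ≡ z′ →
           (∀ u v → Arcs._⟶_ (configArcs (configOf (toℕ k) p)) u v ⇔ Arcs._⟶_ (configArcs (configOf (toℕ k′) q)) u v) →
           (k , z) ≡ (k′ , z′)
      go (a , b) (a′ , b′) refl refl e
        with combConfig-determines (comb (2 * toℕ k) a) (comb (2 * toℕ k′) a′) (perm (toℕ k) b) (perm (toℕ k′) b′) e
      ... | k≡k′ , rest with Fin.toℕ-injective k≡k′
      go (a , b) (a′ , b′) refl refl e | refl , c≡d , π≈ρ | refl =
        cong (k ,_) (cong₂ combine
          (trans (sym (Inverse.strictlyInverseˡ (Comb↔ n (2 * toℕ k)) a))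
                 (trans (cong (Inverse.to (Comb↔ n (2 * toℕ k))) c≡d) (Inverse.strictlyInverseˡ (Comb↔ n (2 * toℕ k)) a′)))
          (perm-injective (toℕ k) π≈ρ))

    member-surjective : ∀ {k} (C : Config n k) → ∃[ x ] ∀ u v → Arcs._⟶_ (member x) u v ⇔ Arcs._⟶_ (configArcs C) u v
    member-surjective {k} C = found (fromℕ< (s≤s k≤n/2)) (Fin.toℕ-fromℕ< (s≤s k≤n/2)) C
      where
      -- The `2 * k` endpoints are distinct vertices, so `2 * k` ≤ `n`, and halving gives the bound.
      k≤n/2 : k ≤ ⌊ n /2⌋
      k≤n/2 = subst (_≤ ⌊ n /2⌋) (trans (cong (λ a → ⌊ k + a /2⌋) (ℕ.+-identityʳ k)) (sym (ℕ.n≡⌊n+n/2⌋ k)))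
                (ℕ.⌊n/2⌋-mono (comb-bound (proj₁ (combConfig-surjective C))))
      found : ∀ (k′ : Fin (suc ⌊ n /2⌋)) {k} → toℕ k′ ≡ k → (C : Config n k) →
              ∃[ x ] ∀ u v → Arcs._⟶_ (member x) u v ⇔ Arcs._⟶_ (configArcs C) u v
      found k′ refl C =
        let c , same = combConfig-surjective C
            y , y≈ = perm-surjective (toℕ k′) (Config.π C)
            x = Inverse.to (Comb↔ n (2 * toℕ k′)) c
        in (k′ , combine x y) ,
           subst (λ p → ∀ u v → Arcs._⟶_ (configArcs (configOf (toℕ k′) p)) u v ⇔ Arcs._⟶_ (configArcs C) u v)
                 (sym (Fin.remQuot-combine x y))
                 (subst (λ d → ∀ u v → Arcs._⟶_ (configArcs (combConfig (toℕ k′) d (perm (toℕ k′) y))) u v ⇔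
                                       Arcs._⟶_ (configArcs C) u v)
                        (sym (Inverse.strictlyInverseʳ (Comb↔ n (2 * toℕ k′)) c))
                        (same (perm (toℕ k′) y) y≈))

    code↔ : Fin (minimalSpeed n) ↔ Code
    code↔ = subst (λ m → Fin m ↔ Code) (sym (minimalSpeed-∑ n)) (↔-sym (Σ-Fin↔ term))

    decode : Fin (minimalSpeed n) → Code
    decode = Inverse.to code↔

    configAt : ∀ x → Config n (toℕ (proj₁ (decode x)))
    configAt x = let k , z = decode x in configOf (toℕ k) (remQuot (toℕ k !) z)

  nthMatching : Fin (minimalSpeed n) → OrderedGraph
  nthMatching x = graph (member (decode x))

  nthMatching⊑H : ∀ x → ∃₂ λ k (π : Permutation′ k) → nthMatching x ⊑ H π
  nthMatching⊑H x = n , IsMatching.partnerPermutation (Config.isMatching (configAt x)) , configGraph⊑H (configAt x)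

  nthMatching-maxDegree : ∀ x → maxDegree (nthMatching x) ≤ 1
  nthMatching-maxDegree x = Config.maxDegree≤1 (configAt x)

  nthMatching-injective : ∀ {x y} → nthMatching x ≅ nthMatching y → x ≡ y
  nthMatching-injective {x} {y} i = trans (sym (Inverse.strictlyInverseʳ code↔ x)) (trans (cong (Inverse.from code↔)
      (member-injective λ u v → mk⇔ (≅⇒⟶ (member (decode x)) (member (decode y)) i)
                                   (≅⇒⟶ (member (decode y)) (member (decode x)) (≅.sym i))))
    (Inverse.strictlyInverseʳ code↔ y))

  -- The ambient `H ρ` may be arbitrarily large: `toConfig` deletes the indices of `ρ` whose arcs
  -- are absent from `G`, leaving a configuration on the `n` vertices of `G`.
  nthMatching-surjective : ∀ G → size G ≡ n → ∀ {k} (ρ : Permutation′ k) → G ⊑ H ρ → ∃[ x ] nthMatching x ≅ G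
  nthMatching-surjective G refl {N} ρ G⊑H =
    let k , C , C⇔A = toConfig (arcs G) f f< ρ (_↑ˡ N) (N ↑ʳ_) (↑ˡ-increasing N) (↑ʳ-increasing N) ↑ˡ<↑ʳ arc⇒
        y , y⇔C = member-surjective C
    in Inverse.from code↔ y , ≅.trans
      (graph-≅ (member (decode (Inverse.from code↔ y))) (arcs G)
        (subst (λ z → ∀ u v → Arcs._⟶_ (member z) u v ⇔ Arcs._⟶_ (arcs G) u v) (sym (Inverse.strictlyInverseˡ code↔ y))
          λ u v → mk⇔ (Equivalence.to (C⇔A u v) ∘ Equivalence.to (y⇔C u v))
                        (Equivalence.from (y⇔C u v) ∘ Equivalence.from (C⇔A u v))))
      (canonical G)
    where
    open _⊑_ (⊑-trans (≅⇒⊑ (canonical G)) G⊑H) renaming (to to f)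
    f< : Increasing f
    f< = Equivalence.to (≺-⇔ _ _)
    Arc⇒< : ∀ {u v} → Arc ρ u v → u Fin.< v
    Arc⇒< (i , refl , refl) = ↑ˡ<↑ʳ i (ρ ⟨$⟩ʳ i)
    arc⇒ : ∀ {u v} → Arcs._⟶_ (arcs G) u v → Arc ρ (f u) (f v)
    arc⇒ a with Adj-⇒ (inj₁ a)
    ... | inj₁ b = b
    ... | inj₂ b = contradiction (Arc⇒< b) (ℕ.<-asym (f< (Arcs.⟶⇒< (arcs G) a)))

-- The extremal property and its uniqueness

-- The property 𝒬 of the theorem, smallest among the monotone properties containing every H(π).
HSubgraph : ∀ {ℓ} → Pred OrderedGraph ℓ
HSubgraph {ℓ} G = Lift ℓ (∃₂ λ k (π : Permutation′ k) → G ⊑ H π)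

HSubgraph-monotone : ∀ {ℓ} → IsMonotoneProperty {ℓ} HSubgraph
HSubgraph-monotone = record
  { respects-≅ = λ i → λ { (lift (k , π , s)) → lift (k , π , ⊑-trans (≅⇒⊑ (≅.sym i)) s) }
  ; monotone   = λ i → λ { (lift (k , π , s)) → lift (k , π , ⊑-trans i s) } }

HSubgraph⊆ : ∀ {ℓ} {P : Pred OrderedGraph ℓ} → IsMonotoneProperty P →
             (∀ k (π : Permutation′ k) → P (H π)) → HSubgraph {ℓ} ⊆ P
HSubgraph⊆ mono allH (lift (k , π , s)) = IsMonotoneProperty.monotone mono s (allH k π)

-- The index of a graph is computed from whichever embedding it comes with; it is independent of the
-- choice because isomorphic entries of the enumeration have equal indices.
HSubgraph-speed : ∀ {ℓ} → HasSpeed {ℓ} HSubgraph minimalSpeed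
HSubgraph-speed n = record
  { to        = λ { (G , eq , lift (_ , π , s)) → proj₁ (nthMatching-surjective n G eq π s) }
  ; from      = λ x → nthMatching n x , refl , lift (nthMatching⊑H n x)
  ; to-cong   = λ { {G , eq , lift (_ , π , s)} {G′ , eq′ , lift (_ , π′ , s′)} i →
      nthMatching-injective n (≅.trans (proj₂ (nthMatching-surjective n G eq π s))
        (≅.trans i (≅.sym (proj₂ (nthMatching-surjective n G′ eq′ π′ s′))))) }
  ; from-cong = λ { refl → ≅.refl }
  ; inverse   = (λ { {_} {G , eq , lift (_ , π , s)} i →
                     nthMatching-injective n (≅.trans (proj₂ (nthMatching-surjective n G eq π s)) i) })
              , (λ { {G , eq , lift (_ , π , s)} refl → proj₂ (nthMatching-surjective n G eq π s) })
  }

-- This lets the first part of the theorem act on any competitor of the same speed, which must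
-- therefore contain every `H π`.
speed⇒superexponential : ∀ {ℓ} {P : Pred OrderedGraph ℓ} → HasSpeed P minimalSpeed → Superexponential P
speed⇒superexponential speed = ℕ⇒superexponential λ a _ →
  let N , lt = minimalSpeed-superexponential a
      open Inverse (speed N)
  in N , minimalSpeed N , lt , record
       { to = from ; cong = from-cong
       ; injective = λ {x} {y} i → trans (sym (strictlyInverseˡ x)) (trans (to-cong i) (strictlyInverseˡ y)) }

-- 𝒬ₙ ⊆ 𝒫ₙ are finite of the same size, hence equal.
⊆HSubgraph : ∀ {ℓ} {P : Pred OrderedGraph ℓ} → HSubgraph {ℓ} ⊆ P → HasSpeed P minimalSpeed → P ⊆ HSubgraph {ℓ}
⊆HSubgraph {P = P} Q⊆P speed {G} p =
  -- Whether `G` embeds in some `H π` is settled by counting: the listed matchings already take all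
  -- the indices, so one of them shares the index of `G` and is isomorphic to it.
  let x , eq = injective⇒surjective {f = index} index-injective (to (G , refl , p))
  in IsMonotoneProperty.respects-≅ HSubgraph-monotone (to-injective eq) (lift (nthMatching⊑H n x))
  where
  n = size G
  open Inverse (speed n)
  to-injective : ∀ {x y} → to x ≡ to y → proj₁ x ≅ proj₁ y
  to-injective {x} {y} eq = ≅.trans (≅.sym (strictlyInverseʳ x)) (≅.trans (from-cong eq) (strictlyInverseʳ y))
  index : Fin (minimalSpeed n) → Fin (minimalSpeed n)
  index x = to (nthMatching n x , refl , Q⊆P (lift (nthMatching⊑H n x)))
  index-injective : Injective _≡_ _≡_ index
  index-injective eq = nthMatching-injective n (to-injective eq)

module _ {ℓ : Level} {P : Pred OrderedGraph ℓ} where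

  ⁽¹˒²⁾-≤ : ∀ n → ∣ graphs (P ⁽¹˒²⁾) n ∣≤∣ graphs P n ∣
  ⁽¹˒²⁾-≤ n = record { to = λ { (G , eq , p , _) → G , eq , p } ; cong = id ; injective = id }

  minimalSpeed≤⁽¹˒²⁾ : HSubgraph {ℓ} ⊆ P → ∀ n → minimalSpeed n ≤∣ graphs (P ⁽¹˒²⁾) n ∣
  minimalSpeed≤⁽¹˒²⁾ Q⊆P n = record
    { to        = λ x → nthMatching n x , refl , Q⊆P (lift (nthMatching⊑H n x)) , nthMatching-maxDegree n x
    ; cong      = λ { refl → ≅.refl }
    ; injective = nthMatching-injective n }

theorem4 : ∀ {ℓ : Level} →
    ((P : Pred OrderedGraph ℓ) → IsMonotoneProperty P → Superexponential P →
    (∀ k (π : Permutation′ k) → P (H π))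
    × (∀ n → ∣ graphs (P ⁽¹˒²⁾) n ∣≤∣ graphs P n ∣
    × minimalSpeed n ≤∣ graphs (P ⁽¹˒²⁾) n ∣))
    × IsHalfPower minimalSpeed
    × (∃[ Q ] IsMonotoneProperty {ℓ} Q × Superexponential Q × HasSpeed Q minimalSpeed)
    × ∃! {A = Pred OrderedGraph ℓ} _≐_ (λ Q → IsMonotoneProperty Q × HasSpeed Q minimalSpeed)
theorem4 =
    (λ P mono superexp → superexponential⇒H mono superexp , λ n →
        ⁽¹˒²⁾-≤ n , minimalSpeed≤⁽¹˒²⁾ (HSubgraph⊆ mono (superexponential⇒H mono superexp)) n)
  , minimalSpeed-isHalfPower
  , (HSubgraph , HSubgraph-monotone , speed⇒superexponential HSubgraph-speed , HSubgraph-speed)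
  , (HSubgraph , (HSubgraph-monotone , HSubgraph-speed) , λ { (mono , speed) →
      let Q⊆P = HSubgraph⊆ mono (superexponential⇒H mono (speed⇒superexponential speed))
      in Q⊆P , ⊆HSubgraph Q⊆P speed })
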